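{- There is an absolute constant $C>0$ such that for every odd integer $t\ge 5$ and all positive integers $n\le m$ (with $m$ sufficiently large) there is a non-adaptive $(m,n,s,t)$-scheme with \[ s\le C\, t\, m^{\frac{2}{t-1}} n^{1-\frac{2}{t-1}}\lg\frac{2m}{n}. \]
   Context: $\lg$ denotes logarithm to base $2$. Let $[m]=\{1,\dots,m\}$. An $(m,n,s)$-storing scheme is a map $\phi$ from the family of subsets of $[m]$ of size at most $n$ to $\{0,1\}^s$. An $(m,s,t)$-query scheme is a family $\{T_u\}_{u\in[m]}$ of Boolean decision trees of depth at most $t$ whose internal nodes are marked with addresses in $\{1,\dots,s\}$ and whose leaves are marked Yes/No; $T_u$ maps $\{0,1\}^s$ to $\{\mathrm{Yes},\mathrm{No}\}$. An $(m,n,s,t)$-scheme is a pair $(\phi,\{T_u\})$ such that for every $S\subseteq[m]$ with $|S|\le n$ and every $u\in[m]$, $T_u(\phi(S))=\mathrm{Yes}$ iff $u\in S$. The scheme is non-adaptive if for each $u$ the set of (at most $t$) locations probed by $T_u$ is fixed, i.e. does not depend on the values read. -}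

module Defs where

open import Data.Nat using (ℕ; zero; suc; _+_; _*_; _^_; _≤_; _<_; _⊔_; _∸_)
open import Data.Bool using (Bool; true; false)
open import Data.Fin using (Fin)
open import Data.Fin.Subset using (Subset; ∣_∣; _∈_)
open import Data.Vec using (Vec; lookup)
open import Data.List using (List; length; []; _∷_)
open import Data.List.Membership.Propositional renaming (_∈_ to _∈ˡ_)
open import Data.Product using (Σ; ∃; _×_; _,_)
open import Relation.Binary.PropositionalEquality using (_≡_)
open import Function.Bundles using (_⇔_)

data DTree (s : ℕ) : Set where
  leaf : Bool → DTree s
  node : Fin s → DTree s → DTree s → DTree s

depth : ∀ {s} → DTree s → ℕ
depth (leaf _)     = 0
depth (node _ l r) = suc (depth l ⊔ depth r)

eval : ∀ {s} → DTree s → Vec Bool s → Bool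
eval (leaf b)     x = b
eval (node i l r) x with lookup x i
... | false = eval l x
... | true  = eval r x

probes : ∀ {s} → DTree s → Vec Bool s → List (Fin s)
probes (leaf b)     x = []
probes (node i l r) x with lookup x i
... | false = i ∷ probes l x
... | true  = i ∷ probes r x

-- (m,n,s)-storing scheme: we take a map on all subsets of [m]; only its values
-- on subsets of size ≤ n matter (any partial map extends to a total one).
StoringScheme : ℕ → ℕ → Set
StoringScheme m s = Subset m → Vec Bool s

QueryScheme : ℕ → ℕ → ℕ → Set
QueryScheme m s t = Σ (Fin m → DTree s) λ T → ∀ u → depth (T u) ≤ t

IsScheme : ∀ m n s t → StoringScheme m s → QueryScheme m s t → Set
IsScheme m n s t φ (T , _) =
  ∀ (S : Subset m) → ∣ S ∣ ≤ n → ∀ (u : Fin m) → (eval (T u) (φ S) ≡ true) ⇔ (u ∈ S)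

NonAdaptive : ∀ {m s t} → QueryScheme m s t → Set
NonAdaptive {m} {s} {t} (T , _) =
  ∀ (u : Fin m) → ∃ λ (P : List (Fin s)) →
    length P ≤ t × (∀ (x : Vec Bool s) (i : Fin s) → i ∈ˡ probes (T u) x → i ∈ˡ P)

-- Real inequality  s ≤ C · t · m^{2/(t-1)} · n^{1-2/(t-1)} · lg(2m/n)
-- for naturals C, t ≥ 3, s, m ≥ n ≥ 1, with k = t - 1, expressed exactly in ℕ:
-- writing P = C t m^{2/k} n^{(k-2)/k} > 0 and L = lg(2m/n), the inequality
-- s ≤ P·L  ⟺  s/P ≤ L  ⟺  every nonnegative rational a/b (b ≥ 1) with a/b < s/P
-- satisfies a/b < L.  Here  a/b < s/P ⟺ (a C t)^k m^2 n^(k-2) < (s b)^k  and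
-- a/b < lg(2m/n) ⟺ 2^a n^b < (2m)^b.
SizeBound : (C t m n s : ℕ) → Set
SizeBound C t m n s =
  ∀ (a b : ℕ) → 1 ≤ b →
    ((a * C * t) ^ k) * (m ^ 2) * (n ^ (k ∸ 2)) < (s * b) ^ k →
    (2 ^ a) * (n ^ b) < (2 * m) ^ b
  where
    k = t ∸ 1

{-# OPTIONS --safe #-}
-- Write t = 2k + 1 and let each u ∈ [m] choose t of the s addresses at random
-- (with repetition); T_u answers by majority.  Let r ≈ lg(64 m/n).  Two union
-- bounds show that some choice has both properties
--   * every nonempty A with ∣A∣ ≤ n + r n has more than (k + 1)∣A∣ neighbours, and
--   * for every S with ∣S∣ ≤ n, fewer than r n elements outside S have k + 1 or
--     more of their probes among the neighbours of S.
-- Given S, let T be the exceptional elements of the second property.  By Hall's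
-- theorem and the first property, the elements of S ∪ T have k + 1 private
-- addresses each.  Store 1 at the private addresses of S and 0 elsewhere: the
-- majority is then right on S and T by the private addresses, and on all other
-- elements because at most k of their probes meet neighbours of S.
module Submission where

open import Defs
open import Data.Bool using (true; false; if_then_else_)
open import Data.Empty using (⊥-elim)
open import Data.Fin using (Fin; zero; suc)
import Data.Fin as Fin
open import Data.Fin.Properties using (any?)
open import Data.Fin.Subset using (Subset; ∣_∣; _∈_; _∉_; _⊆_; _∪_; _∩_; _-_; ∁; ⊥; ⁅_⁆; inside; outside)
open import Data.Fin.Subset.Properties
open import Data.List using (List; []; _∷_; _++_; map; length; allFin; cartesianProductWith; upTo)
open import Data.List.Membership.Propositional using () renaming (_∈_ to _∈ˡ_)
open import Data.List.Membership.Propositional.Properties using (∈-cartesianProductWith⁺; ∈-allFin; ∈-upTo⁺)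
open import Data.List.Properties using (length-++; length-map; map-tabulate; map-applyUpTo; length-tabulate)
open import Data.List.Relation.Unary.Any using (here; there)
open import Data.Nat
open import Data.Nat.DivMod using (m≡m%n+[m/n]*n; m%n<n; m/n*n≤m)
open import Data.Nat.Induction using (<-wellFounded)
open import Data.Nat.Properties
open import Data.Nat.Tactic.RingSolver using (solve-∀)
open import Data.Product using (Σ; ∃; _×_; _,_; proj₁; proj₂)
open import Data.Sum using (_⊎_; inj₁; inj₂)
open import Data.Vec using (Vec; []; _∷_; lookup; here; there; toList)
open import Data.Vec.Properties using (length-toList; lookup⇒[]=; []=⇒lookup)
open import Function using (_∘_; id)
open import Function.Bundles using (mk⇔)
open import Induction.WellFounded using (Acc; acc)
open import Relation.Binary.PropositionalEquality hiding (J)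
open import Relation.Nullary using (Dec; does; yes; no; ¬_; ¬?)
open import Relation.Nullary.Decidable using (_×-dec_; dec-true; dec-false)

-- Inequalities between powers

-- For a fixed S the available bound on the chance that a given outside element is exceptional is
-- only 1/z with z ≈ m/n, so about n exceptional elements must be reckoned with. The union bound
-- over S has up to (4z)^n terms and needs a tail smaller than that. It comes from the variable
-- 2^∣T∣: once the neighbours of S are frozen, the rows outside S are independent and its mean is at
-- most (1 + 1/z)^m ≤ 4^n. Markov's inequality at r n then asks for 2^r ≥ 64 z, where 64 = 4 · 4 · 4
-- pays for the number of sets S, for the mean, and for a failure probability of 1/4. Since T joins
-- S in Hall's theorem, expansion is needed up to size n + r n. The union bound over A succeeds when
-- s^k is at least a constant to the k times t^k m (r n)^(k-1); the k-th root gives m^(1/k)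
-- n^(1-1/k), where 1/k = 2/(t-1), and r supplies the logarithm. Probabilities appear as numbers of
-- tables with denominators multiplied out. The two failure probabilities are at most 1/3 and 1/4,
-- so a good table remains.

^-distribʳ-* : ∀ m n k → (m * n) ^ k ≡ m ^ k * n ^ k
^-distribʳ-* m n zero    = refl
^-distribʳ-* m n (suc k) = begin
  m * n * (m * n) ^ k       ≡⟨ cong (m * n *_) (^-distribʳ-* m n k) ⟩
  m * n * (m ^ k * n ^ k)   ≡⟨ [m*n]*[o*p]≡[m*o]*[n*p] m n (m ^ k) (n ^ k) ⟩
  m * m ^ k * (n * n ^ k)   ∎
  where open ≡-Reasoning

^-cancelˡ-≤ : ∀ k {m n} → m ^ suc k ≤ n ^ suc k → m ≤ n
^-cancelˡ-≤ k {m} {n} le with m ≤? n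
... | yes m≤n = m≤n
... | no  m≰n = ⊥-elim (<⇒≱ (^-monoˡ-< (suc k) (≰⇒> m≰n)) le)

^-cancelˡ-< : ∀ k {m n} → m ^ k < n ^ k → m < n
^-cancelˡ-< k {m} {n} lt with m <? n
... | yes m<n = m<n
... | no  m≮n = ⊥-elim (<⇒≱ lt (^-monoˡ-≤ k (≮⇒≥ m≮n)))

-- Bernoulli's inequality (1 - 1/(z+1))^h ≥ 1 - h/(z+1) without denominators; `d` stands for z + 1 -
-- h and so avoids truncated subtraction.
bernoulli : ∀ z h d → h + d ≡ suc z → suc z ^ h * d ≤ z ^ h * suc z
bernoulli z zero    d eq = *-monoʳ-≤ 1 (≤-reflexive eq)
bernoulli z (suc h) d eq = begin
  suc z * suc z ^ h * d    ≡⟨ shuffle₁ (suc z) (suc z ^ h) d ⟩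
  suc z ^ h * (d + z * d)  ≤⟨ *-monoʳ-≤ (suc z ^ h) (+-monoˡ-≤ (z * d) d≤z) ⟩
  suc z ^ h * (z + z * d)  ≡⟨ shuffle₂ z (suc z ^ h) d ⟩
  z * (suc z ^ h * suc d)  ≤⟨ *-monoʳ-≤ z (bernoulli z h (suc d) (trans (+-suc h d) eq)) ⟩
  z * (z ^ h * suc z)      ≡⟨ *-assoc z (z ^ h) (suc z) ⟨
  z * z ^ h * suc z        ∎
  where
  open ≤-Reasoning
  d≤z : d ≤ z
  d≤z = subst (d ≤_) (suc-injective eq) (m≤n+m d h)
  shuffle₁ : ∀ a b c → a * b * c ≡ b * (a * c)
  shuffle₁ = solve-∀
  shuffle₂ : ∀ a b c → b * (a + a * c) ≡ a * (b * suc c)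
  shuffle₂ = solve-∀

-- (1 + 1/z)^z ≤ 4, the square of (1 + 1/z)^⌈z/2⌉ ≤ 2.
suc^≤4*^ : ∀ z → suc z ^ z ≤ 4 * z ^ z
suc^≤4*^ z = *-cancelʳ-≤ _ _ (suc z ^ e) (begin
  suc z ^ z * suc z ^ e          ≡⟨ ^-distribˡ-+-* (suc z) z e ⟨
  suc z ^ (z + e)                ≡⟨ cong (suc z ^_) z+e≡2h ⟩
  suc z ^ (h + h)                ≡⟨ ^-distribˡ-+-* (suc z) h h ⟩
  suc z ^ h * suc z ^ h          ≤⟨ *-mono-≤ half half ⟩
  2 * z ^ h * (2 * z ^ h)        ≡⟨ [m*n]*[o*p]≡[m*o]*[n*p] 2 (z ^ h) 2 (z ^ h) ⟩
  4 * (z ^ h * z ^ h)            ≡⟨ cong (4 *_) (sym (^-distribˡ-+-* z h h)) ⟩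
  4 * z ^ (h + h)                ≡⟨ cong (λ x → 4 * z ^ x) (sym z+e≡2h) ⟩
  4 * z ^ (z + e)                ≡⟨ cong (4 *_) (^-distribˡ-+-* z z e) ⟩
  4 * (z ^ z * z ^ e)            ≤⟨ *-monoʳ-≤ 4 (*-monoʳ-≤ (z ^ z) (^-monoˡ-≤ e (n≤1+n z))) ⟩
  4 * (z ^ z * suc z ^ e)        ≡⟨ *-assoc 4 (z ^ z) _ ⟨
  4 * z ^ z * suc z ^ e          ∎)
  where
  open ≤-Reasoning
  h = ⌈ z /2⌉
  d = ⌈ suc z /2⌉
  z≤2h : z ≤ h + h
  z≤2h = subst (_≤ h + h) (⌊n/2⌋+⌈n/2⌉≡n z) (+-monoˡ-≤ h (⌊n/2⌋≤⌈n/2⌉ z))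
  e = h + h ∸ z
  z+e≡2h : z + e ≡ h + h
  z+e≡2h = m+[n∸m]≡n z≤2h
  instance
    _ : NonZero (suc z ^ e)
    _ = m^n≢0 (suc z) e
  h+d≡1+z : h + d ≡ suc z
  h+d≡1+z = ⌊n/2⌋+⌈n/2⌉≡n (suc z)
  1+z≤2d : suc z ≤ d * 2
  1+z≤2d = begin
    suc z    ≡⟨ h+d≡1+z ⟨
    h + d    ≤⟨ +-monoˡ-≤ d (⌊n/2⌋≤⌈n/2⌉ (suc z)) ⟩
    d + d    ≡⟨ m+m≡m*2 d ⟩
    d * 2    ∎
    where
    m+m≡m*2 : ∀ m → m + m ≡ m * 2
    m+m≡m*2 = solve-∀
  half : suc z ^ h ≤ 2 * z ^ h
  half = *-cancelʳ-≤ _ _ (suc z) (begin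
    suc z ^ h * suc z     ≤⟨ *-monoʳ-≤ (suc z ^ h) 1+z≤2d ⟩
    suc z ^ h * (d * 2)   ≡⟨ *-assoc (suc z ^ h) d 2 ⟨
    suc z ^ h * d * 2     ≤⟨ *-monoˡ-≤ 2 (bernoulli z h d h+d≡1+z) ⟩
    z ^ h * suc z * 2     ≡⟨ shuffle (z ^ h) (suc z) ⟩
    2 * z ^ h * suc z     ∎)
    where
    shuffle : ∀ a b → a * b * 2 ≡ 2 * a * b
    shuffle = solve-∀

-- Padding the exponent m to z n reduces (1 + 1/z)^m ≤ 4^n to n copies of the previous bound. It is
-- applied twice later: to the number of stored sets and to the exponential moment.
suc^≤4^*^ : ∀ z n m → m ≤ z * n → suc z ^ m ≤ 4 ^ n * z ^ m
suc^≤4^*^ zero      n m m≤zn rewrite n≤0⇒n≡0 m≤zn = *-mono-≤ (m^n>0 4 n) ≤-refl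
suc^≤4^*^ z@(suc _) n m m≤zn = *-cancelʳ-≤ _ _ (z ^ e) (begin
  suc z ^ m * z ^ e       ≤⟨ *-monoʳ-≤ (suc z ^ m) (^-monoˡ-≤ e (n≤1+n z)) ⟩
  suc z ^ m * suc z ^ e   ≡⟨ ^-distribˡ-+-* (suc z) m e ⟨
  suc z ^ (m + e)         ≡⟨ cong (suc z ^_) m+e≡zn ⟩
  suc z ^ (z * n)         ≡⟨ ^-*-assoc (suc z) z n ⟨
  (suc z ^ z) ^ n         ≤⟨ ^-monoˡ-≤ n (suc^≤4*^ z) ⟩
  (4 * z ^ z) ^ n         ≡⟨ ^-distribʳ-* 4 (z ^ z) n ⟩
  4 ^ n * (z ^ z) ^ n     ≡⟨ cong (4 ^ n *_) (^-*-assoc z z n) ⟩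
  4 ^ n * z ^ (z * n)     ≡⟨ cong (λ x → 4 ^ n * z ^ x) (sym m+e≡zn) ⟩
  4 ^ n * z ^ (m + e)     ≡⟨ cong (4 ^ n *_) (^-distribˡ-+-* z m e) ⟩
  4 ^ n * (z ^ m * z ^ e) ≡⟨ *-assoc (4 ^ n) (z ^ m) (z ^ e) ⟨
  4 ^ n * z ^ m * z ^ e   ∎)
  where
  open ≤-Reasoning
  e = z * n ∸ m
  m+e≡zn : m + e ≡ z * n
  m+e≡zn = m+[n∸m]≡n m≤zn
  instance
    _ : NonZero (z ^ e)
    _ = m^n≢0 z e

-- A crude Stirling bound: passing from n to n + 1 multiplies n^n / n! by (n+1)^n / n^n, which is at
-- most 4. It turns m^a / a! into (4m/a)^a in the union bound over sets of size a.
n^n≤4^n*n! : ∀ n → n ^ n ≤ 4 ^ n * n !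
n^n≤4^n*n! zero    = ≤-refl
n^n≤4^n*n! (suc n) = begin
  suc n * suc n ^ n         ≤⟨ *-monoʳ-≤ (suc n) (suc^≤4*^ n) ⟩
  suc n * (4 * n ^ n)       ≤⟨ *-monoʳ-≤ (suc n) (*-monoʳ-≤ 4 (n^n≤4^n*n! n)) ⟩
  suc n * (4 * (4 ^ n * n !)) ≡⟨ shuffle (suc n) (4 ^ n) (n !) ⟩
  4 * 4 ^ n * (suc n * n !) ∎
  where
  open ≤-Reasoning
  shuffle : ∀ a b c → a * (4 * (b * c)) ≡ 4 * b * (a * c)
  shuffle = solve-∀

-- Only powers of two are tried: y doubles when x overtakes its power. This costs the factor
-- 2^(k+1), that is, a factor 2 in y, which the absolute constant absorbs.
ceil-root : ∀ k x → 1 ≤ x → ∃ λ y → x ≤ y ^ suc k × y ^ suc k ≤ 2 ^ suc k * x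
ceil-root k (suc zero)        _ = 1 , ≤-reflexive (sym (^-zeroˡ (suc k))) , (begin
  1 ^ suc k         ≡⟨ ^-zeroˡ (suc k) ⟩
  1                 ≤⟨ m^n>0 2 (suc k) ⟩
  2 ^ suc k         ≡⟨ *-identityʳ _ ⟨
  2 ^ suc k * 1     ∎)
  where open ≤-Reasoning
ceil-root k (suc x@(suc _)) _ with ceil-root k x (s≤s z≤n)
... | y , x≤y^k , y^k≤2^kx with suc x ≤? y ^ suc k
...   | yes x<y^k = y , x<y^k , ≤-trans y^k≤2^kx (*-monoʳ-≤ (2 ^ suc k) (n≤1+n x))
...   | no  x≮y^k = 2 * y , double , tight
  where
  open ≤-Reasoning
  y^k≤x : y ^ suc k ≤ x
  y^k≤x = s≤s⁻¹ (≰⇒> x≮y^k)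
  double : suc x ≤ (2 * y) ^ suc k
  double = begin
    suc x                     ≤⟨ +-monoˡ-≤ x (s≤s (z≤n {n = pred x})) ⟩
    x + x                     ≡⟨ cong (x +_) (sym (+-identityʳ x)) ⟩
    2 * x                     ≤⟨ *-mono-≤ (m≤m*n 2 (2 ^ k) ⦃ m^n≢0 2 k ⦄) x≤y^k ⟩
    2 ^ suc k * y ^ suc k     ≡⟨ ^-distribʳ-* 2 y (suc k) ⟨
    (2 * y) ^ suc k           ∎
  tight : (2 * y) ^ suc k ≤ 2 ^ suc k * suc x
  tight = begin
    (2 * y) ^ suc k           ≡⟨ ^-distribʳ-* 2 y (suc k) ⟩
    2 ^ suc k * y ^ suc k     ≤⟨ *-monoʳ-≤ (2 ^ suc k) (≤-trans y^k≤x (n≤1+n x)) ⟩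
    2 ^ suc k * suc x         ∎

ceil-log : ∀ x → 1 ≤ x → ∃ λ r → x ≤ 2 ^ r × 2 ^ r ≤ 2 * x
ceil-log (suc zero)      _ = 0 , ≤-refl , s≤s z≤n
ceil-log (suc x@(suc _)) _ with ceil-log x (s≤s z≤n)
... | r , x≤2^r , 2^r≤2x with suc x ≤? 2 ^ r
...   | yes x<2^r = r , x<2^r , ≤-trans 2^r≤2x (*-monoʳ-≤ 2 (n≤1+n x))
...   | no  x≮2^r = suc r , double , *-monoʳ-≤ 2 (≤-trans (s≤s⁻¹ (≰⇒> x≮2^r)) (n≤1+n x))
  where
  open ≤-Reasoning
  double : suc x ≤ 2 ^ suc r
  double = begin
    suc x        ≤⟨ +-monoˡ-≤ x (s≤s (z≤n {n = pred x})) ⟩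
    x + x        ≡⟨ cong (x +_) (sym (+-identityʳ x)) ⟩
    2 * x        ≤⟨ *-monoʳ-≤ 2 x≤2^r ⟩
    2 * 2 ^ r    ∎

-- Finite sums

private
  variable
    I J : Set
    m s : ℕ

∑ : List I → (I → ℕ) → ℕ
∑ []       f = 0
∑ (x ∷ xs) f = f x + ∑ xs f

infix 5 ∑
syntax ∑ xs (λ x → e) = ∑[ x ∈ xs ] e

𝟙 : ∀ {P : Set} → Dec P → ℕ
𝟙 P? = if does P? then 1 else 0

𝟙-yes : ∀ {P : Set} (P? : Dec P) → P → 𝟙 P? ≡ 1
𝟙-yes (yes _)  _ = refl
𝟙-yes (no ¬p)  p = ⊥-elim (¬p p)

𝟙-no : ∀ {P : Set} (P? : Dec P) → ¬ P → 𝟙 P? ≡ 0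
𝟙-no (yes p) ¬p = ⊥-elim (¬p p)
𝟙-no (no _)  _  = refl

𝟙≡0 : ∀ {P : Set} (P? : Dec P) → 𝟙 P? ≡ 0 → ¬ P
𝟙≡0 (no ¬p) _ = ¬p

𝟙≤1 : ∀ {P : Set} (P? : Dec P) → 𝟙 P? ≤ 1
𝟙≤1 (yes _) = ≤-refl
𝟙≤1 (no _)  = z≤n

𝟙-mono : ∀ {P Q : Set} (P? : Dec P) (Q? : Dec Q) → (P → Q) → 𝟙 P? ≤ 𝟙 Q?
𝟙-mono (yes p) Q? f = ≤-reflexive (sym (𝟙-yes Q? (f p)))
𝟙-mono (no _)  Q? f = z≤n

𝟙-*-monoʳ-≤ : ∀ {P : Set} (P? : Dec P) {m n} → (P → m ≤ n) → 𝟙 P? * m ≤ 𝟙 P? * n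
𝟙-*-monoʳ-≤ (yes p) m≤n = *-monoʳ-≤ 1 (m≤n p)
𝟙-*-monoʳ-≤ (no _)  m≤n = z≤n

∑-mono : ∀ (xs : List I) {f g : I → ℕ} → (∀ x → f x ≤ g x) → ∑ xs f ≤ ∑ xs g
∑-mono []       f≤g = z≤n
∑-mono (x ∷ xs) f≤g = +-mono-≤ (f≤g x) (∑-mono xs f≤g)

∑-cong : ∀ (xs : List I) {f g : I → ℕ} → (∀ x → f x ≡ g x) → ∑ xs f ≡ ∑ xs g
∑-cong []       f≡g = refl
∑-cong (x ∷ xs) f≡g = cong₂ _+_ (f≡g x) (∑-cong xs f≡g)

∑-++ : ∀ (xs ys : List I) f → ∑ (xs ++ ys) f ≡ ∑ xs f + ∑ ys f
∑-++ []       ys f = refl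
∑-++ (x ∷ xs) ys f = trans (cong (f x +_) (∑-++ xs ys f)) (sym (+-assoc (f x) _ _))

∑-map : ∀ (g : I → J) xs f → ∑ (map g xs) f ≡ ∑ xs (f ∘ g)
∑-map g []       f = refl
∑-map g (x ∷ xs) f = cong (f (g x) +_) (∑-map g xs f)

∑-const : ∀ (xs : List I) c → ∑ xs (λ _ → c) ≡ length xs * c
∑-const []       c = refl
∑-const (x ∷ xs) c = cong (c +_) (∑-const xs c)

∑-+ : ∀ (xs : List I) f g → ∑[ x ∈ xs ] (f x + g x) ≡ ∑ xs f + ∑ xs g
∑-+ []       f g = refl
∑-+ (x ∷ xs) f g = trans (cong (f x + g x +_) (∑-+ xs f g)) ([m+n]+[o+p]≡[m+o]+[n+p] (f x) (g x) _ _)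
  where
  [m+n]+[o+p]≡[m+o]+[n+p] : ∀ m n o p → (m + n) + (o + p) ≡ (m + o) + (n + p)
  [m+n]+[o+p]≡[m+o]+[n+p] = solve-∀

∑-*ˡ : ∀ (xs : List I) c f → ∑[ x ∈ xs ] (c * f x) ≡ c * ∑ xs f
∑-*ˡ []       c f = sym (*-zeroʳ c)
∑-*ˡ (x ∷ xs) c f = trans (cong (c * f x +_) (∑-*ˡ xs c f)) (sym (*-distribˡ-+ c (f x) _))

∑-*ʳ : ∀ (xs : List I) c f → ∑[ x ∈ xs ] (f x * c) ≡ ∑ xs f * c
∑-*ʳ []       c f = refl
∑-*ʳ (x ∷ xs) c f = trans (cong (f x * c +_) (∑-*ʳ xs c f)) (sym (*-distribʳ-+ c (f x) _))

∑-comm : ∀ (xs : List I) (ys : List J) (f : I → J → ℕ) → ∑[ x ∈ xs ] ∑[ y ∈ ys ] f x y ≡ ∑[ y ∈ ys ] ∑[ x ∈ xs ] f x y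
∑-comm []       ys f = sym (trans (∑-const ys 0) (*-zeroʳ (length ys)))
∑-comm (x ∷ xs) ys f = trans (cong (∑ ys (f x) +_) (∑-comm xs ys f)) (sym (∑-+ ys (f x) _))

∑≡0⇒≡0 : ∀ (xs : List I) {f} → ∑ xs f ≡ 0 → ∀ {x} → x ∈ˡ xs → f x ≡ 0
∑≡0⇒≡0 (x ∷ xs) {f} eq (here refl) = m+n≡0⇒m≡0 (f x) eq
∑≡0⇒≡0 (x ∷ xs) {f} eq (there x∈)  = ∑≡0⇒≡0 xs (m+n≡0⇒n≡0 (f x) eq) x∈

-- The first-moment method: with f counting defects, a mean below 1 forces a defect-free entry.
∑<length⇒∃≡0 : ∀ (xs : List I) f → ∑ xs f < length xs → ∃ λ x → f x ≡ 0
∑<length⇒∃≡0 (x ∷ xs) f lt with f x in fx≡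
... | zero  = x , fx≡
... | suc i = ∑<length⇒∃≡0 xs f (≤-<-trans (m≤n+m _ i) (s≤s⁻¹ lt))

vecs : List I → ∀ n → List (Vec I n)
vecs xs zero    = [] ∷ []
vecs xs (suc n) = cartesianProductWith _∷_ xs (vecs xs n)

∑-× : ∀ {K : Set} (g : I → J → K) xs ys f →
      ∑ (cartesianProductWith g xs ys) f ≡ ∑[ x ∈ xs ] ∑[ y ∈ ys ] f (g x y)
∑-× g []       ys f = refl
∑-× g (x ∷ xs) ys f =
  trans (∑-++ (map (g x) ys) _ f) (cong₂ _+_ (∑-map (g x) ys f) (∑-× g xs ys f))

∑-vecs : ∀ (xs : List I) n (f : Vec I (suc n) → ℕ) →
         ∑ (vecs xs (suc n)) f ≡ ∑[ x ∈ xs ] ∑[ v ∈ vecs xs n ] f (x ∷ v)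
∑-vecs xs n = ∑-× _∷_ xs (vecs xs n)

length-vecs : ∀ (xs : List I) n → length (vecs xs n) ≡ length xs ^ n
length-vecs xs zero    = refl
length-vecs xs (suc n) = trans (length-× xs (vecs xs n)) (cong (length xs *_) (length-vecs xs n))
  where
  length-× : ∀ {I J K : Set} {g : I → J → K} xs ys → length (cartesianProductWith g xs ys) ≡ length xs * length ys
  length-× []       ys = refl
  length-× {g = g} (x ∷ xs) ys =
    trans (length-++ (map (g x) ys)) (cong₂ _+_ (length-map (g x) ys) (length-× xs ys))

∈-vecs : ∀ {xs : List I} → (∀ x → x ∈ˡ xs) → ∀ {n} (v : Vec I n) → v ∈ˡ vecs xs n
∈-vecs all []      = here refl
∈-vecs all (x ∷ v) = ∈-cartesianProductWith⁺ _∷_ (all x) (∈-vecs all v)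

∑-allFin-suc : ∀ n (f : Fin (suc n) → ℕ) → ∑ (allFin (suc n)) f ≡ f zero + ∑ (allFin n) (f ∘ suc)
∑-allFin-suc n f = cong (f zero +_)
  (trans (cong (λ xs → ∑ xs f) (sym (map-tabulate id suc))) (∑-map suc (allFin n) f))

∑-upTo-suc : ∀ n (f : ℕ → ℕ) → ∑ (upTo (suc n)) f ≡ f 0 + ∑ (upTo n) (f ∘ suc)
∑-upTo-suc n f = cong (f 0 +_)
  (trans (cong (λ xs → ∑ xs f) (sym (map-applyUpTo id suc n))) (∑-map suc (upTo n) f))

-- The series c/4 + c/16 + ... stays below c/3. The induction keeps `c` fixed by passing to the
-- shifted sequence multiplied by 4.
∑-geometric : ∀ n (f : ℕ → ℕ) c → (∀ i → i < n → f i * 4 ^ suc i ≤ c) → 3 * ∑ (upTo n) f ≤ c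
∑-geometric zero    f c f≤ = z≤n
∑-geometric (suc n) f c f≤ = *-cancelˡ-≤ 4 (begin
  4 * (3 * ∑ (upTo (suc n)) f)            ≡⟨ cong (λ x → 4 * (3 * x)) (∑-upTo-suc n f) ⟩
  4 * (3 * (f 0 + ∑ (upTo n) (f ∘ suc)))  ≡⟨ shuffle (f 0) _ ⟩
  3 * (f 0 * 4) + 3 * (4 * ∑ (upTo n) (f ∘ suc))
    ≡⟨ cong (λ x → 3 * (f 0 * 4) + 3 * x) (sym (∑-*ˡ (upTo n) 4 (f ∘ suc))) ⟩
  3 * (f 0 * 4) + 3 * (∑[ i ∈ upTo n ] (4 * f (suc i)))
    ≤⟨ +-mono-≤ (*-monoʳ-≤ 3 (f≤ 0 (s≤s z≤n))) (∑-geometric n (λ i → 4 * f (suc i)) c tail) ⟩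
  3 * c + c                               ≡⟨ +-comm (3 * c) c ⟩
  4 * c                                   ∎)
  where
  open ≤-Reasoning
  shuffle : ∀ a b → 4 * (3 * (a + b)) ≡ 3 * (a * 4) + 3 * (4 * b)
  shuffle = solve-∀
  tail : ∀ i → i < n → 4 * f (suc i) * 4 ^ suc i ≤ c
  tail i i<n = ≤-trans (≤-reflexive ([m*n]*o≡n*[m*o] 4 (f (suc i)) (4 ^ suc i))) (f≤ (suc i) (s≤s i<n))
    where
    [m*n]*o≡n*[m*o] : ∀ m n o → m * n * o ≡ n * (m * o)
    [m*n]*o≡n*[m*o] = solve-∀

-- Counting subsets

subsets : ∀ m → List (Subset m)
subsets = vecs (inside ∷ outside ∷ [])

∈-subsets : ∀ (p : Subset m) → p ∈ˡ subsets m
∈-subsets = ∈-vecs λ { true → here refl ; false → there (here refl) }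

∑-subsets-suc : ∀ m (f : Subset (suc m) → ℕ) →
                ∑ (subsets (suc m)) f ≡ ∑ (subsets m) (f ∘ (inside ∷_)) + ∑ (subsets m) (f ∘ (outside ∷_))
∑-subsets-suc m f = trans (∑-× _∷_ (inside ∷ outside ∷ []) (subsets m) f)
  (cong (∑ (subsets m) (f ∘ (inside ∷_)) +_) (+-identityʳ _))

-- These are the two leading terms of the binomial expansion of (m+1)^(a+1), the amount that
-- Pascal's rule produces in the next count.
suc-*-^≤suc^suc : ∀ m a → suc a * m ^ a + m ^ suc a ≤ suc m ^ suc a
suc-*-^≤suc^suc m zero    = ≤-reflexive (eq m)
  where
  eq : ∀ m → 1 + m * 1 ≡ 1 * 1 + m * 1
  eq = solve-∀
suc-*-^≤suc^suc m (suc a) = begin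
  suc (suc a) * (m * m ^ a) + m * (m * m ^ a)        ≡⟨ shuffle a m (m ^ a) ⟩
  m * m ^ a + m * (suc a * m ^ a + m * m ^ a)
    ≤⟨ +-mono-≤ (^-monoˡ-≤ (suc a) (n≤1+n m)) (*-monoʳ-≤ m (suc-*-^≤suc^suc m a)) ⟩
  suc m ^ suc a + m * suc m ^ suc a                  ∎
  where
  open ≤-Reasoning
  shuffle : ∀ a m p → suc (suc a) * (m * p) + m * (m * p) ≡ m * p + m * (suc a * p + m * p)
  shuffle = solve-∀

#subsets-of-size : ∀ m a → (∑[ p ∈ subsets m ] 𝟙 (∣ p ∣ ≟ a)) * a ! ≤ m ^ a
#subsets-of-size zero    zero    = ≤-refl
#subsets-of-size zero    (suc a) = z≤n
#subsets-of-size (suc m) zero    = begin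
  (∑[ p ∈ subsets (suc m) ] 𝟙 (∣ p ∣ ≟ 0)) * 1  ≡⟨ cong (_* 1) (∑-subsets-suc m (λ p → 𝟙 (∣ p ∣ ≟ 0))) ⟩
  ((∑[ p ∈ subsets m ] 0) + (∑[ p ∈ subsets m ] 𝟙 (∣ p ∣ ≟ 0))) * 1
    ≡⟨ cong (λ x → (x + (∑[ p ∈ subsets m ] 𝟙 (∣ p ∣ ≟ 0))) * 1)
         (trans (∑-const (subsets m) 0) (*-zeroʳ (length (subsets m)))) ⟩
  (∑[ p ∈ subsets m ] 𝟙 (∣ p ∣ ≟ 0)) * 1        ≤⟨ #subsets-of-size m zero ⟩
  1                                             ∎
  where open ≤-Reasoning
#subsets-of-size (suc m) (suc a) = begin
  (∑[ p ∈ subsets (suc m) ] 𝟙 (∣ p ∣ ≟ suc a)) * (suc a * a !)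
    ≡⟨ cong (_* (suc a * a !)) (∑-subsets-suc m (λ p → 𝟙 (∣ p ∣ ≟ suc a))) ⟩
  (N a + N (suc a)) * (suc a * a !)
    ≡⟨ shuffle (N a) (N (suc a)) (suc a) (a !) ⟩
  suc a * (N a * a !) + N (suc a) * (suc a * a !)
    ≤⟨ +-mono-≤ (*-monoʳ-≤ (suc a) (#subsets-of-size m a)) (#subsets-of-size m (suc a)) ⟩
  suc a * m ^ a + m ^ suc a
    ≤⟨ suc-*-^≤suc^suc m a ⟩
  suc m ^ suc a
    ∎
  where
  open ≤-Reasoning
  N : ℕ → ℕ
  N b = ∑[ p ∈ subsets m ] 𝟙 (∣ p ∣ ≟ b)
  shuffle : ∀ x y b c → (x + y) * (b * c) ≡ b * (x * c) + y * (b * c)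
  shuffle = solve-∀

-- In the expansion (z+1)^m = Σ z^(m - ∣p∣) over all p, each p with at most n elements has weight at
-- least z^m / z^n, because z ≥ 1. With z ≈ m/n this gives at most (4z)^n stored sets.
#subsets-of-size≤ : ∀ m z .⦃ _ : NonZero z ⦄ n →
  (∑[ p ∈ subsets m ] 𝟙 (∣ p ∣ ≤? n)) * z ^ m ≤ z ^ n * suc z ^ m
#subsets-of-size≤ zero    z n = *-monoˡ-≤ 1 (≤-trans (≤-reflexive (+-identityʳ _))
  (≤-trans (𝟙≤1 (0 ≤? n)) (m^n>0 z n)))
#subsets-of-size≤ (suc m) z zero = begin
  (∑[ p ∈ subsets (suc m) ] 𝟙 (∣ p ∣ ≤? 0)) * z ^ suc m
    ≡⟨ cong (_* z ^ suc m) (∑-subsets-suc m (λ p → 𝟙 (∣ p ∣ ≤? 0))) ⟩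
  ((∑[ p ∈ subsets m ] 0) + N) * z ^ suc m
    ≡⟨ cong (λ x → (x + N) * z ^ suc m) (trans (∑-const (subsets m) 0) (*-zeroʳ (length (subsets m)))) ⟩
  N * (z * z ^ m)         ≡⟨ shuffle N z (z ^ m) ⟩
  z * (N * z ^ m)         ≤⟨ *-mono-≤ (n≤1+n z) (#subsets-of-size≤ m z zero) ⟩
  suc z * (1 * suc z ^ m) ≡⟨ *-identityˡ-inner (suc z) (suc z ^ m) ⟩
  1 * (suc z * suc z ^ m) ∎
  where
  open ≤-Reasoning
  N = ∑[ p ∈ subsets m ] 𝟙 (∣ p ∣ ≤? 0)
  shuffle : ∀ a b c → a * (b * c) ≡ b * (a * c)
  shuffle = solve-∀
  *-identityˡ-inner : ∀ a b → a * (1 * b) ≡ 1 * (a * b)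
  *-identityˡ-inner = solve-∀
#subsets-of-size≤ (suc m) z (suc n) = begin
  (∑[ p ∈ subsets (suc m) ] 𝟙 (∣ p ∣ ≤? suc n)) * z ^ suc m
    ≡⟨ cong (_* z ^ suc m) (∑-subsets-suc m (λ p → 𝟙 (∣ p ∣ ≤? suc n))) ⟩
  ((∑[ p ∈ subsets m ] 𝟙 (suc ∣ p ∣ ≤? suc n)) + N (suc n)) * z ^ suc m
    ≤⟨ *-monoˡ-≤ (z ^ suc m) (+-monoˡ-≤ (N (suc n)) (∑-mono (subsets m)
         λ p → 𝟙-mono (suc ∣ p ∣ ≤? suc n) (∣ p ∣ ≤? n) s≤s⁻¹)) ⟩
  (N n + N (suc n)) * (z * z ^ m)
    ≡⟨ shuffle₁ (N n) (N (suc n)) z (z ^ m) ⟩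
  z * (N n * z ^ m) + z * (N (suc n) * z ^ m)
    ≤⟨ +-mono-≤ (*-monoʳ-≤ z (#subsets-of-size≤ m z n)) (*-monoʳ-≤ z (#subsets-of-size≤ m z (suc n))) ⟩
  z * (z ^ n * suc z ^ m) + z * (z ^ suc n * suc z ^ m)
    ≡⟨ shuffle₂ z (z ^ n) (suc z ^ m) ⟩
  z ^ suc n * suc z ^ suc m
    ∎
  where
  open ≤-Reasoning
  N : ℕ → ℕ
  N b = ∑[ p ∈ subsets m ] 𝟙 (∣ p ∣ ≤? b)
  shuffle₁ : ∀ x y a b → (x + y) * (a * b) ≡ a * (x * b) + a * (y * b)
  shuffle₁ = solve-∀
  shuffle₂ : ∀ z p q → z * (p * q) + z * (z * p * q) ≡ z * p * ((1 + z) * q)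
  shuffle₂ = solve-∀

-- Coverage of random rows

∑-∈ : ∀ (p : Subset s) → ∑[ x ∈ allFin s ] 𝟙 (x ∈? p) ≡ ∣ p ∣
∑-∈ []            = refl
∑-∈ (true  ∷ p) = trans (∑-allFin-suc _ (λ x → 𝟙 (x ∈? (inside ∷ p)))) (cong suc (∑-∈ p))
∑-∈ (false ∷ p) = trans (∑-allFin-suc _ (λ x → 𝟙 (x ∈? (outside ∷ p)))) (∑-∈ p)

x∈p⇒p∪⁅x⁆≡p : ∀ {p : Subset s} {x} → x ∈ p → p ∪ ⁅ x ⁆ ≡ p
x∈p⇒p∪⁅x⁆≡p {p = _ ∷ p} here = cong (inside ∷_) (∪-identityʳ p)
x∈p⇒p∪⁅x⁆≡p {p = true  ∷ p} (there x∈p) = cong (inside  ∷_) (x∈p⇒p∪⁅x⁆≡p x∈p)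
x∈p⇒p∪⁅x⁆≡p {p = false ∷ p} (there x∈p) = cong (outside ∷_) (x∈p⇒p∪⁅x⁆≡p x∈p)

x∉p⇒∣p∪⁅x⁆∣≡1+∣p∣ : ∀ {p : Subset s} {x} → x ∉ p → ∣ p ∪ ⁅ x ⁆ ∣ ≡ suc ∣ p ∣
x∉p⇒∣p∪⁅x⁆∣≡1+∣p∣ {p = true  ∷ p} {zero}  x∉p = ⊥-elim (x∉p here)
x∉p⇒∣p∪⁅x⁆∣≡1+∣p∣ {p = false ∷ p} {zero}  x∉p = cong (suc ∘ ∣_∣) (∪-identityʳ p)
x∉p⇒∣p∪⁅x⁆∣≡1+∣p∣ {p = true  ∷ p} {suc x} x∉p = cong suc (x∉p⇒∣p∪⁅x⁆∣≡1+∣p∣ (x∉p ∘ there))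
x∉p⇒∣p∪⁅x⁆∣≡1+∣p∣ {p = false ∷ p} {suc x} x∉p = x∉p⇒∣p∪⁅x⁆∣≡1+∣p∣ (x∉p ∘ there)

nbrs : ∀ {L} → Vec (Fin s) L → Subset s
nbrs []      = ⊥
nbrs (x ∷ r) = ⁅ x ⁆ ∪ nbrs r

cover : (Fin m → Subset s) → Subset m → Subset s
cover F []          = ⊥
cover F (true  ∷ A) = F zero ∪ cover (F ∘ suc) A
cover F (false ∷ A) = cover (F ∘ suc) A

rows : ∀ s L → List (Vec (Fin s) L)
rows s = vecs (allFin s)

N : ∀ {L} → Vec (Vec (Fin s) L) m → Subset m → Subset s
N G = cover (λ u → nbrs (lookup G u))

-- Φ W counts the ways to extend the set W of addresses seen so far without
-- exceeding w addresses.  Each new probe either hits one of at most w old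
-- addresses or uses up one unit of j = w − ∣ W ∣, whence the factor 2w.
record Extends {s : ℕ} (w B : ℕ) (Φ : Subset s → ℕ) : Set where
  constructor extends
  field
    bound  : ∀ W j → ∣ W ∣ + j ≡ w → Φ W * w ^ j ≤ B * s ^ j
    vanish : ∀ W → w < ∣ W ∣ → Φ W ≡ 0

extends-probe : ∀ {w B} {Φ : Subset s → ℕ} → Extends w B Φ →
                Extends w (2 * w * B) (λ W → ∑[ x ∈ allFin s ] Φ (W ∪ ⁅ x ⁆))
extends-probe {s} {w} {B} {Φ} (extends bound vanish) = extends bound′ vanish′
  where
  open ≤-Reasoning
  vanish′ : ∀ W → w < ∣ W ∣ → ∑[ x ∈ allFin s ] Φ (W ∪ ⁅ x ⁆) ≡ 0
  vanish′ W w<W = trans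
    (∑-cong (allFin s) λ x → vanish (W ∪ ⁅ x ⁆) (≤-trans w<W (∣p∣≤∣p∪q∣ W ⁅ x ⁆)))
    (trans (∑-const (allFin s) 0) (*-zeroʳ (length (allFin s))))

  -- `c` is the price of a fresh address. It is 0 when `j` is 0, since the budget is then spent and
  -- `vanish` applies; otherwise a fresh address lowers `j` by one, and `bound` gives w B s^(j-1).
  split : ∀ W j c → ∣ W ∣ + j ≡ w → (∀ x → x ∉ W → Φ (W ∪ ⁅ x ⁆) * w ^ j ≤ c) →
          (∑[ x ∈ allFin s ] Φ (W ∪ ⁅ x ⁆)) * w ^ j ≤ w * (B * s ^ j) + s * c
  split W j c eq fresh = begin
    (∑[ x ∈ allFin s ] Φ (W ∪ ⁅ x ⁆)) * w ^ j        ≡⟨ ∑-*ʳ (allFin s) (w ^ j) _ ⟨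
    ∑[ x ∈ allFin s ] (Φ (W ∪ ⁅ x ⁆) * w ^ j)        ≤⟨ ∑-mono (allFin s) each ⟩
    ∑[ x ∈ allFin s ] (𝟙 (x ∈? W) * (B * s ^ j) + c) ≡⟨ ∑-+ (allFin s) _ _ ⟩
    (∑[ x ∈ allFin s ] (𝟙 (x ∈? W) * (B * s ^ j))) + (∑[ x ∈ allFin s ] c)
      ≡⟨ cong₂ _+_ (trans (∑-*ʳ (allFin s) (B * s ^ j) _) (cong (_* (B * s ^ j)) (∑-∈ W)))
           (trans (∑-const (allFin s) c) (cong (_* c) (length-tabulate {n = s} id))) ⟩
    ∣ W ∣ * (B * s ^ j) + s * c
      ≤⟨ +-monoˡ-≤ (s * c) (*-monoˡ-≤ (B * s ^ j) (m+n≤o⇒m≤o ∣ W ∣ (≤-reflexive eq))) ⟩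
    w * (B * s ^ j) + s * c                          ∎
    where
    each : ∀ x → Φ (W ∪ ⁅ x ⁆) * w ^ j ≤ 𝟙 (x ∈? W) * (B * s ^ j) + c
    each x with x ∈? W
    ... | no x∉W  = fresh x x∉W
    ... | yes x∈W rewrite x∈p⇒p∪⁅x⁆≡p x∈W | +-identityʳ (B * s ^ j) = ≤-trans (bound W j eq) (m≤m+n _ c)

  bound′ : ∀ W j → ∣ W ∣ + j ≡ w →
           (∑[ x ∈ allFin s ] Φ (W ∪ ⁅ x ⁆)) * w ^ j ≤ 2 * w * B * s ^ j
  bound′ W zero eq = begin
    (∑[ x ∈ allFin s ] Φ (W ∪ ⁅ x ⁆)) * 1  ≤⟨ split W 0 0 eq fresh ⟩
    w * (B * 1) + s * 0                    ≡⟨ shuffle w B s ⟩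
    w * B                                  ≤⟨ m≤m+n (w * B) (w * B) ⟩
    w * B + w * B                          ≡⟨ double w B ⟩
    2 * w * B * 1                          ∎
    where
    shuffle : ∀ a b c → a * (b * 1) + c * 0 ≡ a * b
    shuffle = solve-∀
    double : ∀ a b → a * b + a * b ≡ 2 * a * b * 1
    double = solve-∀
    fresh : ∀ x → x ∉ W → Φ (W ∪ ⁅ x ⁆) * 1 ≤ 0
    fresh x x∉W = ≤-reflexive (cong (_* 1) (vanish (W ∪ ⁅ x ⁆)
      (≤-reflexive (trans (cong suc (trans (sym eq) (+-identityʳ _))) (sym (x∉p⇒∣p∪⁅x⁆∣≡1+∣p∣ x∉W))))))
  bound′ W (suc j) eq = begin
    (∑[ x ∈ allFin s ] Φ (W ∪ ⁅ x ⁆)) * w ^ suc j  ≤⟨ split W (suc j) (w * (B * s ^ j)) eq fresh ⟩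
    w * (B * (s * s ^ j)) + s * (w * (B * s ^ j))  ≡⟨ shuffle w B s (s ^ j) ⟩
    2 * w * B * (s * s ^ j)                        ∎
    where
    shuffle : ∀ w b s p → w * (b * (s * p)) + s * (w * (b * p)) ≡ 2 * w * b * (s * p)
    shuffle = solve-∀
    fresh : ∀ x → x ∉ W → Φ (W ∪ ⁅ x ⁆) * (w * w ^ j) ≤ w * (B * s ^ j)
    fresh x x∉W = begin
      Φ (W ∪ ⁅ x ⁆) * (w * w ^ j)  ≡⟨ [m*n*o]≡n*[m*o] (Φ (W ∪ ⁅ x ⁆)) w (w ^ j) ⟩
      w * (Φ (W ∪ ⁅ x ⁆) * w ^ j)  ≤⟨ *-monoʳ-≤ w (bound (W ∪ ⁅ x ⁆) j
          (trans (cong (_+ j) (x∉p⇒∣p∪⁅x⁆∣≡1+∣p∣ x∉W)) (trans (sym (+-suc ∣ W ∣ j)) eq))) ⟩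
      w * (B * s ^ j)              ∎
      where
      [m*n*o]≡n*[m*o] : ∀ m n o → m * (n * o) ≡ n * (m * o)
      [m*n*o]≡n*[m*o] = solve-∀

extends-cong : ∀ {w B B′} {Φ Ψ : Subset s → ℕ} → B ≡ B′ → (∀ W → Φ W ≡ Ψ W) → Extends w B Φ → Extends w B′ Ψ
extends-cong refl Φ≡Ψ (extends bound vanish) = extends
  (λ W j eq → subst (λ x → x * _ ≤ _) (Φ≡Ψ W) (bound W j eq))
  (λ W lt → trans (sym (Φ≡Ψ W)) (vanish W lt))

extends-row : ∀ {w B} {Φ : Subset s → ℕ} L → Extends w B Φ →
              Extends w ((2 * w) ^ L * B) (λ W → ∑[ r ∈ rows s L ] Φ (W ∪ nbrs r))
extends-row {w = w} {B} {Φ} zero    ext = extends-cong (sym (*-identityˡ B))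
  (λ W → trans (cong Φ (sym (∪-identityʳ W))) (sym (+-identityʳ _))) ext
extends-row {s} {w} {B} {Φ} (suc L) ext = extends-cong (sym (*-assoc (2 * w) _ B))
  (λ W → sym (trans (∑-vecs (allFin s) L _)
      (∑-cong (allFin s) λ x → ∑-cong (rows s L) λ r → cong Φ (sym (∪-assoc W ⁅ x ⁆ (nbrs r))))))
  (extends-probe (extends-row L ext))

coverBound : ∀ (s w L : ℕ) → Subset m → ℕ
coverBound s w L []          = 1
coverBound s w L (true  ∷ A) = (2 * w) ^ L * coverBound s w L A
coverBound s w L (false ∷ A) = length (rows s L) * coverBound s w L A

-- The set W is arbitrary so that rows can be peeled off the front of the table: a row of A enlarges
-- W, while any other row leaves W alone and contributes all its choices. With no rows left, the
-- indicator is at most 1 and `w ≤ s` gives w^j ≤ s^j.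
extends-cover : ∀ {w} L → w ≤ s → ∀ (A : Subset m) →
  Extends w (coverBound s w L A) (λ W → ∑[ G ∈ vecs (rows s L) m ] 𝟙 (∣ W ∪ N G A ∣ ≤? w))
extends-cover {w = w} L w≤s [] = extends
  (λ W j _ → *-mono-≤ (≤-trans (≤-reflexive (+-identityʳ _)) (𝟙≤1 (∣ W ∪ ⊥ ∣ ≤? w))) (^-monoˡ-≤ j w≤s))
  λ W w<W → trans (+-identityʳ _) (𝟙-no (∣ W ∪ ⊥ ∣ ≤? w) (<⇒≱ (≤-trans w<W (∣p∣≤∣p∪q∣ W ⊥))))
extends-cover {s} {suc m} {w} L w≤s (true ∷ A) = extends-cong refl
  (λ W → sym (trans (∑-vecs (rows s L) m _)
      (∑-cong (rows s L) λ r → ∑-cong (vecs (rows s L) m) λ G →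
         cong (λ V → 𝟙 (∣ V ∣ ≤? w)) (sym (∪-assoc W (nbrs r) (N G A))))))
  (extends-row L (extends-cover L w≤s A))
extends-cover {s} {suc m} {w} L w≤s (false ∷ A) with extends-cover {s} {m} L w≤s A
... | extends bound vanish = extends-cong refl
  (λ W → sym (trans (∑-vecs (rows s L) m _) (∑-const (rows s L) _)))
  (extends
    (λ W j eq → ≤-trans (≤-reflexive (*-assoc ρ _ _))
       (≤-trans (*-monoʳ-≤ ρ (bound W j eq)) (≤-reflexive (sym (*-assoc ρ _ _)))))
    λ W lt → trans (cong (ρ *_) (vanish W lt)) (*-zeroʳ ρ))
  where
  ρ = length (rows s L)

length-rows : ∀ s L → length (rows s L) ≡ s ^ L
length-rows s L = trans (length-vecs (allFin s) L) (cong (_^ L) (length-tabulate {n = s} id))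

-- The power for the rows of A stands on the left in place of an exponent m - ∣A∣ on the right.
coverBound-* : ∀ s w L (A : Subset m) →
  coverBound s w L A * length (rows s L) ^ ∣ A ∣ ≡ ((2 * w) ^ L) ^ ∣ A ∣ * length (rows s L) ^ m
coverBound-* s w L []          = refl
coverBound-* {suc m} s w L (true ∷ A) = begin
  p * c * (ρ * ρ ^ ∣ A ∣)         ≡⟨ shuffle₁ p c ρ (ρ ^ ∣ A ∣) ⟩
  p * ρ * (c * ρ ^ ∣ A ∣)         ≡⟨ cong (p * ρ *_) (coverBound-* s w L A) ⟩
  p * ρ * (p ^ ∣ A ∣ * ρ ^ m)     ≡⟨ [m*n]*[o*p]≡[m*o]*[n*p] p ρ (p ^ ∣ A ∣) (ρ ^ m) ⟩
  p * p ^ ∣ A ∣ * (ρ * ρ ^ m)     ∎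
  where
  open ≡-Reasoning
  p = (2 * w) ^ L
  c = coverBound s w L A
  ρ = length (rows s L)
  shuffle₁ : ∀ p c r q → p * c * (r * q) ≡ p * r * (c * q)
  shuffle₁ = solve-∀
coverBound-* {suc m} s w L (false ∷ A) = begin
  ρ * c * ρ ^ ∣ A ∣               ≡⟨ *-assoc ρ c _ ⟩
  ρ * (c * ρ ^ ∣ A ∣)             ≡⟨ cong (ρ *_) (coverBound-* s w L A) ⟩
  ρ * (p ^ ∣ A ∣ * ρ ^ m)         ≡⟨ shuffle ρ (p ^ ∣ A ∣) (ρ ^ m) ⟩
  p ^ ∣ A ∣ * (ρ * ρ ^ m)         ∎
  where
  open ≡-Reasoning
  p = (2 * w) ^ L
  c = coverBound s w L A
  ρ = length (rows s L)
  shuffle : ∀ a b c → a * (b * c) ≡ b * (a * c)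
  shuffle = solve-∀

tables : ∀ m s t → List (Vec (Vec (Fin s) t) m)
tables m s t = vecs (rows s t) m

-- Take W empty and w = d∣A∣. Of the (k + d)∣A∣ probes at most w find a fresh address, so at least
-- k∣A∣ are repeats of probability at most w/s each, and 2^((k+d)∣A∣) allows for which probes these
-- are. In the formulas this is the cancellation of w^w and s^w.
#small-cover : ∀ s .⦃ _ : NonZero s ⦄ k d (A : Subset m) .⦃ _ : NonZero (d * ∣ A ∣) ⦄ → d * ∣ A ∣ ≤ s →
  (∑[ G ∈ tables m s (k + d) ] 𝟙 (∣ N G A ∣ ≤? d * ∣ A ∣)) * (s ^ k) ^ ∣ A ∣
    ≤ (2 ^ (k + d) * (d * ∣ A ∣) ^ k) ^ ∣ A ∣ * length (rows s (k + d)) ^ m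
#small-cover {m} s k d A w≤s = *-cancelʳ-≤ _ _ (w ^ w * s ^ w) ⦃ m*n≢0 (w ^ w) (s ^ w) ⦄ (begin
  c * (s ^ k) ^ a * (w ^ w * s ^ w)     ≡⟨ shuffle₁ c ((s ^ k) ^ a) (w ^ w) (s ^ w) ⟩
  c * w ^ w * ((s ^ k) ^ a * s ^ w)     ≡⟨ cong (c * w ^ w *_) (sym ρ^a) ⟩
  c * w ^ w * ρ ^ a                     ≤⟨ *-monoˡ-≤ (ρ ^ a) c≤ ⟩
  b * s ^ w * ρ ^ a                     ≡⟨ shuffle₂ b (s ^ w) (ρ ^ a) ⟩
  b * ρ ^ a * s ^ w                     ≡⟨ cong (_* s ^ w) (coverBound-* s w t A) ⟩
  ((2 * w) ^ t) ^ a * ρ ^ m * s ^ w     ≡⟨ cong (λ x → x * ρ ^ m * s ^ w) [2w]^t^a ⟩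
  (2 ^ t * w ^ k) ^ a * w ^ w * ρ ^ m * s ^ w
    ≡⟨ shuffle₃ ((2 ^ t * w ^ k) ^ a) (w ^ w) (ρ ^ m) (s ^ w) ⟩
  (2 ^ t * w ^ k) ^ a * ρ ^ m * (w ^ w * s ^ w) ∎)
  where
  open ≤-Reasoning
  t = k + d
  a = ∣ A ∣
  w = d * a
  ρ = length (rows s t)
  b = coverBound s w t A
  c = ∑[ G ∈ tables m s t ] 𝟙 (∣ N G A ∣ ≤? w)
  instance
    _ : NonZero (w ^ w)
    _ = m^n≢0 w w
    _ : NonZero (s ^ w)
    _ = m^n≢0 s w
  c≤ : c * w ^ w ≤ b * s ^ w
  c≤ = subst (λ x → x * w ^ w ≤ b * s ^ w)
    (∑-cong (tables m s t) λ G → cong (λ V → 𝟙 (∣ V ∣ ≤? w)) (∪-identityˡ (N G A)))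
    (Extends.bound (extends-cover t w≤s A) ⊥ w (cong (_+ w) (∣⊥∣≡0 s)))
  ρ^a : ρ ^ a ≡ (s ^ k) ^ a * s ^ w
  ρ^a = ≡.begin
    ρ ^ a                        ≡.≡⟨ cong (_^ a) (trans (length-rows s t) (^-distribˡ-+-* s k d)) ⟩
    (s ^ k * s ^ d) ^ a          ≡.≡⟨ ^-distribʳ-* (s ^ k) (s ^ d) a ⟩
    (s ^ k) ^ a * (s ^ d) ^ a    ≡.≡⟨ cong ((s ^ k) ^ a *_) (^-*-assoc s d a) ⟩
    (s ^ k) ^ a * s ^ w          ≡.∎
    where module ≡ = ≡-Reasoning
  [2w]^t^a : ((2 * w) ^ t) ^ a ≡ (2 ^ t * w ^ k) ^ a * w ^ w
  [2w]^t^a = ≡.begin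
    ((2 * w) ^ t) ^ a                   ≡.≡⟨ cong (_^ a) (^-distribʳ-* 2 w t) ⟩
    (2 ^ t * w ^ t) ^ a                 ≡.≡⟨ cong (λ x → (2 ^ t * x) ^ a) (^-distribˡ-+-* w k d) ⟩
    (2 ^ t * (w ^ k * w ^ d)) ^ a       ≡.≡⟨ cong (_^ a) (sym (*-assoc (2 ^ t) _ _)) ⟩
    (2 ^ t * w ^ k * w ^ d) ^ a         ≡.≡⟨ ^-distribʳ-* (2 ^ t * w ^ k) (w ^ d) a ⟩
    (2 ^ t * w ^ k) ^ a * (w ^ d) ^ a   ≡.≡⟨ cong ((2 ^ t * w ^ k) ^ a *_) (^-*-assoc w d a) ⟩
    (2 ^ t * w ^ k) ^ a * w ^ w         ≡.∎
    where module ≡ = ≡-Reasoning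
  shuffle₁ : ∀ c x y z → c * x * (y * z) ≡ c * y * (x * z)
  shuffle₁ = solve-∀
  shuffle₂ : ∀ x y z → x * y * z ≡ x * z * y
  shuffle₂ = solve-∀
  shuffle₃ : ∀ x y z v → x * y * z * v ≡ x * z * (y * v)
  shuffle₃ = solve-∀

-- The union bound over the at most m^a / a! sets of size a. One of the k factors a in (d a)^k is
-- absorbed by a!, which leaves m a^(k-1): the origin of the exponents of m and n in the theorem. In
-- 16 = 4 · 4, one factor comes from the Stirling bound and the other makes the failure probability
-- decay like 4^(-a).
#small-covers-of-size : ∀ m s .⦃ _ : NonZero s ⦄ κ d .⦃ _ : NonZero d ⦄ a .⦃ _ : NonZero a ⦄ →
  let k = suc κ ; t = k + d in
  16 * (2 ^ t * (d ^ k * (m * a ^ κ))) ≤ s ^ k →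
  (∑[ A ∈ subsets m ] (𝟙 (∣ A ∣ ≟ a) * (∑[ G ∈ tables m s t ] 𝟙 (∣ N G A ∣ ≤? d * ∣ A ∣)))) * 4 ^ a
    ≤ length (rows s t) ^ m
#small-covers-of-size m s κ d a large = *-cancelʳ-≤ _ _ ((s ^ k) ^ a) ⦃ m^n≢0 (s ^ k) a ⦃ m^n≢0 s k ⦄ ⦄ (begin
  (∑[ A ∈ subsets m ] (𝟙 (∣ A ∣ ≟ a) * c A)) * 4 ^ a * (s ^ k) ^ a
    ≡⟨ shuffle₁ (∑[ A ∈ subsets m ] (𝟙 (∣ A ∣ ≟ a) * c A)) (4 ^ a) ((s ^ k) ^ a) ⟩
  (∑[ A ∈ subsets m ] (𝟙 (∣ A ∣ ≟ a) * c A)) * (s ^ k) ^ a * 4 ^ a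
    ≡⟨ cong (_* 4 ^ a) (sym (∑-*ʳ (subsets m) ((s ^ k) ^ a) _)) ⟩
  (∑[ A ∈ subsets m ] (𝟙 (∣ A ∣ ≟ a) * c A * (s ^ k) ^ a)) * 4 ^ a
    ≤⟨ *-monoˡ-≤ (4 ^ a) (∑-mono (subsets m) each) ⟩
  (∑[ A ∈ subsets m ] (𝟙 (∣ A ∣ ≟ a) * (P ^ a * Ω))) * 4 ^ a
    ≡⟨ cong (_* 4 ^ a) (∑-*ʳ (subsets m) (P ^ a * Ω) _) ⟩
  n * (P ^ a * Ω) * 4 ^ a
    ≡⟨ shuffle₂ n (P ^ a) Ω (4 ^ a) ⟩
  Ω * (n * (4 ^ a * P ^ a))
    ≤⟨ *-monoʳ-≤ Ω n*4^a*P^a≤ ⟩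
  Ω * (s ^ k) ^ a
    ∎)
  where
  open ≤-Reasoning
  k = suc κ
  t = k + d
  P = 2 ^ t * (d * a) ^ k
  Y = 4 * (2 ^ t * (d ^ k * a ^ κ))
  Ω = length (rows s t) ^ m
  n = ∑[ A ∈ subsets m ] 𝟙 (∣ A ∣ ≟ a)
  c : Subset m → ℕ
  c A = ∑[ G ∈ tables m s t ] 𝟙 (∣ N G A ∣ ≤? d * ∣ A ∣)

  -- `#small-cover` requires w ≤ s. The condition a ≤ m is supplied by any A that has size a.
  d*a≤s : a ≤ m → d * a ≤ s
  d*a≤s a≤m = ^-cancelˡ-≤ κ (begin
    (d * a) ^ k                             ≡⟨ ^-distribʳ-* d a k ⟩
    d ^ k * (a * a ^ κ)                     ≤⟨ *-monoʳ-≤ (d ^ k) (*-monoˡ-≤ (a ^ κ) a≤m) ⟩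
    d ^ k * (m * a ^ κ)                     ≤⟨ m≤n*m _ (16 * 2 ^ t) ⦃ m*n≢0 16 (2 ^ t) ⦃ _ ⦄ ⦃ m^n≢0 2 t ⦄ ⦄ ⟩
    16 * 2 ^ t * (d ^ k * (m * a ^ κ))      ≡⟨ *-assoc 16 (2 ^ t) _ ⟩
    16 * (2 ^ t * (d ^ k * (m * a ^ κ)))    ≤⟨ large ⟩
    s ^ k                                   ∎)

  each : ∀ A → 𝟙 (∣ A ∣ ≟ a) * c A * (s ^ k) ^ a ≤ 𝟙 (∣ A ∣ ≟ a) * (P ^ a * Ω)
  each A = begin
    𝟙 (∣ A ∣ ≟ a) * c A * (s ^ k) ^ a     ≡⟨ *-assoc (𝟙 (∣ A ∣ ≟ a)) (c A) _ ⟩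
    𝟙 (∣ A ∣ ≟ a) * (c A * (s ^ k) ^ a)   ≤⟨ 𝟙-*-monoʳ-≤ (∣ A ∣ ≟ a) size-a ⟩
    𝟙 (∣ A ∣ ≟ a) * (P ^ a * Ω)           ∎
    where
    size-a : ∣ A ∣ ≡ a → c A * (s ^ k) ^ a ≤ P ^ a * Ω
    size-a eq = subst (λ b → c A * (s ^ k) ^ b ≤ (2 ^ t * (d * b) ^ k) ^ b * Ω) eq
      (#small-cover s k d A ⦃ subst (λ b → NonZero (d * b)) (sym eq) (m*n≢0 d a) ⦄
        (subst (λ b → d * b ≤ s) (sym eq) (d*a≤s (subst (_≤ m) eq (∣p∣≤n A)))))

  n*4^a*P^a≤ : n * (4 ^ a * P ^ a) ≤ (s ^ k) ^ a
  n*4^a*P^a≤ = begin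
    n * (4 ^ a * P ^ a)             ≡⟨ cong (n *_) (^-distribʳ-* 4 P a) ⟨
    n * (4 * P) ^ a                 ≡⟨ cong (λ x → n * x ^ a) 4P≡a*Y ⟩
    n * (a * Y) ^ a                 ≡⟨ cong (n *_) (^-distribʳ-* a Y a) ⟩
    n * (a ^ a * Y ^ a)             ≤⟨ *-monoʳ-≤ n (*-monoˡ-≤ (Y ^ a) (n^n≤4^n*n! a)) ⟩
    n * (4 ^ a * a ! * Y ^ a)       ≡⟨ shuffle₃ n (4 ^ a) (a !) (Y ^ a) ⟩
    n * a ! * (4 ^ a * Y ^ a)       ≤⟨ *-monoˡ-≤ (4 ^ a * Y ^ a) (#subsets-of-size m a) ⟩
    m ^ a * (4 ^ a * Y ^ a)         ≡⟨ cong (m ^ a *_) (^-distribʳ-* 4 Y a) ⟨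
    m ^ a * (4 * Y) ^ a             ≡⟨ ^-distribʳ-* m (4 * Y) a ⟨
    (m * (4 * Y)) ^ a               ≤⟨ ^-monoˡ-≤ a (≤-trans (≤-reflexive (shuffle₄ m (2 ^ t) (d ^ k) (a ^ κ))) large) ⟩
    (s ^ k) ^ a                     ∎
    where
    4P≡a*Y : 4 * P ≡ a * Y
    4P≡a*Y = trans (cong (λ x → 4 * (2 ^ t * x)) (^-distribʳ-* d a k))
      (shuffle₅ (2 ^ t) (d ^ k) a (a ^ κ))
      where
      shuffle₅ : ∀ x y a z → 4 * (x * (y * (a * z))) ≡ a * (4 * (x * (y * z)))
      shuffle₅ = solve-∀
    shuffle₃ : ∀ n x y z → n * (x * y * z) ≡ n * y * (x * z)
    shuffle₃ = solve-∀
    shuffle₄ : ∀ m x y z → m * (4 * (4 * (x * (y * z)))) ≡ 16 * (x * (y * (m * z)))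
    shuffle₄ = solve-∀
  shuffle₁ : ∀ x y z → x * y * z ≡ x * z * y
  shuffle₁ = solve-∀
  shuffle₂ : ∀ n p o q → n * (p * o) * q ≡ o * (n * (q * p))
  shuffle₂ = solve-∀

-- Hall's theorem with demands

∣p∪q∣+∣p∩q∣≡∣p∣+∣q∣ : ∀ (p q : Subset s) → ∣ p ∪ q ∣ + ∣ p ∩ q ∣ ≡ ∣ p ∣ + ∣ q ∣
∣p∪q∣+∣p∩q∣≡∣p∣+∣q∣ []          []          = refl
∣p∪q∣+∣p∩q∣≡∣p∣+∣q∣ (true  ∷ p) (true  ∷ q) = cong suc (trans (+-suc _ _)
  (trans (cong suc (∣p∪q∣+∣p∩q∣≡∣p∣+∣q∣ p q)) (sym (+-suc ∣ p ∣ ∣ q ∣))))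
∣p∪q∣+∣p∩q∣≡∣p∣+∣q∣ (true  ∷ p) (false ∷ q) = cong suc (∣p∪q∣+∣p∩q∣≡∣p∣+∣q∣ p q)
∣p∪q∣+∣p∩q∣≡∣p∣+∣q∣ (false ∷ p) (true  ∷ q) =
  trans (cong suc (∣p∪q∣+∣p∩q∣≡∣p∣+∣q∣ p q)) (sym (+-suc ∣ p ∣ ∣ q ∣))
∣p∪q∣+∣p∩q∣≡∣p∣+∣q∣ (false ∷ p) (false ∷ q) = ∣p∪q∣+∣p∩q∣≡∣p∣+∣q∣ p q

∣p∪q∣≤∣p∣+∣q∣ : ∀ (p q : Subset s) → ∣ p ∪ q ∣ ≤ ∣ p ∣ + ∣ q ∣
∣p∪q∣≤∣p∣+∣q∣ p q = ≤-trans (m≤m+n _ _) (≤-reflexive (∣p∪q∣+∣p∩q∣≡∣p∣+∣q∣ p q))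

∈-cover⁺ : ∀ (F : Fin m → Subset s) {A u x} → u ∈ A → x ∈ F u → x ∈ cover F A
∈-cover⁺ F {A = true  ∷ A} here        x∈ = p⊆p∪q (cover (F ∘ suc) A) x∈
∈-cover⁺ F {A = true  ∷ A} (there u∈A) x∈ = q⊆p∪q (F zero) _ (∈-cover⁺ (F ∘ suc) u∈A x∈)
∈-cover⁺ F {A = false ∷ A} (there u∈A) x∈ = ∈-cover⁺ (F ∘ suc) u∈A x∈

∈-cover⁻ : ∀ (F : Fin m → Subset s) A {x} → x ∈ cover F A → ∃ λ u → u ∈ A × x ∈ F u
∈-cover⁻ F []          x∈ = ⊥-elim (∉⊥ x∈)
∈-cover⁻ F (true  ∷ A) x∈ with x∈p∪q⁻ (F zero) (cover (F ∘ suc) A) x∈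
... | inj₁ x∈F = zero , here , x∈F
... | inj₂ x∈c with ∈-cover⁻ (F ∘ suc) A x∈c
...   | u , u∈A , x∈F = suc u , there u∈A , x∈F
∈-cover⁻ F (false ∷ A) x∈ with ∈-cover⁻ (F ∘ suc) A x∈
... | u , u∈A , x∈F = suc u , there u∈A , x∈F

∑-mono-< : ∀ (xs : List I) {f g : I → ℕ} {x} → (∀ y → f y ≤ g y) → x ∈ˡ xs → f x < g x → ∑ xs f < ∑ xs g
∑-mono-< (_ ∷ xs) f≤g (here refl) lt = +-mono-<-≤ lt (∑-mono xs f≤g)
∑-mono-< (y ∷ xs) f≤g (there x∈)  lt = +-mono-≤-< (f≤g y) (∑-mono-< xs f≤g x∈ lt)

delete : (Fin m → Subset s) → Fin m → Fin s → Fin m → Subset s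
delete F u x v = if does (v Fin.≟ u) then F v - x else F v

delete-⊆ : ∀ (F : Fin m → Subset s) u x v → delete F u x v ⊆ F v
delete-⊆ F u x v with v Fin.≟ u
... | yes _ = p─q⊆p (F v) ⁅ x ⁆
... | no  _ = id

∈-delete : ∀ (F : Fin m → Subset s) {u x v y} → ¬ (v ≡ u × y ≡ x) → y ∈ F v → y ∈ delete F u x v
∈-delete F {u} {x} {v} kept y∈ with v Fin.≟ u
... | yes v≡u = x∈p∧x≢y⇒x∈p-y y∈ (λ y≡x → kept (v≡u , y≡x))
... | no  _   = y∈

∣delete∣< : ∀ (F : Fin m → Subset s) u {x} → x ∈ F u → ∣ delete F u x u ∣ < ∣ F u ∣
∣delete∣< F u x∈ with u Fin.≟ u
... | yes _  = x∈p⇒∣p-x∣<∣p∣ x∈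
... | no u≢u = ⊥-elim (u≢u refl)

module _ (d : ℕ) (A : Subset m) where

  Hall : (Fin m → Subset s) → Set
  Hall F = ∀ B → B ⊆ A → d * ∣ B ∣ ≤ ∣ cover F B ∣

  Violator : (Fin m → Subset s) → Subset m → Set
  Violator F B = B ⊆ A × ∣ cover F B ∣ < d * ∣ B ∣

  hall⊎violator : ∀ (F : Fin m → Subset s) → Hall F ⊎ ∃ (Violator F)
  hall⊎violator F with anySubset? (λ B → (B ⊆? A) ×-dec (∣ cover F B ∣ <? d * ∣ B ∣))
  ... | yes violator = inj₂ violator
  ... | no  none     = inj₁ λ B B⊆A → ≮⇒≥ λ lt → none (B , B⊆A , lt)

  -- If v belonged to P, the address x would stay covered through F v. Deleting it from F u would
  -- then leave the cover of P unchanged, against Hall's condition for F.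
  violator-avoids : ∀ (F : Fin m → Subset s) → Hall F → ∀ {u v x P} → u ≢ v → x ∈ F v →
                    Violator (delete F u x) P → v ∉ P
  violator-avoids F hall {u} {v} {x} {P} u≢v x∈Fv (P⊆A , lt) v∈P =
    <⇒≱ (<-≤-trans lt (hall P P⊆A)) (p⊆q⇒∣p∣≤∣q∣ same)
    where
    same : cover F P ⊆ cover (delete F u x) P
    same {y} y∈ with ∈-cover⁻ F P y∈
    ... | w , w∈P , y∈Fw with y Fin.≟ x
    ...   | yes refl = ∈-cover⁺ _ v∈P (∈-delete F (λ (v≡u , _) → u≢v (sym v≡u)) x∈Fv)
    ...   | no  y≢x  = ∈-cover⁺ _ w∈P (∈-delete F (λ (_ , y≡x) → y≢x y≡x) y∈Fw)

  -- Rado's argument: submodularity of B ↦ ∣ cover F B ∣ shows that an address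
  -- shared by F u and F v can be deleted from one of the two.
  no-two-violators : ∀ (F : Fin m → Subset s) → Hall F → ∀ {u v x P Q} → u ≢ v → x ∈ F u → x ∈ F v →
                     Violator (delete F u x) P → ¬ Violator (delete F v x) Q
  no-two-violators F hall {u} {v} {x} {P} {Q} u≢v x∈Fu x∈Fv violP@(P⊆A , ltP) violQ@(Q⊆A , ltQ) =
    1+n≰n (begin
      2 + (∣ Cᵤ ∣ + ∣ Cᵥ ∣)                        ≡⟨ cong suc (+-suc ∣ Cᵤ ∣ ∣ Cᵥ ∣) ⟨
      suc ∣ Cᵤ ∣ + suc ∣ Cᵥ ∣                      ≤⟨ +-mono-≤ ltP ltQ ⟩
      d * ∣ P ∣ + d * ∣ Q ∣                        ≡⟨ *-distribˡ-+ d ∣ P ∣ ∣ Q ∣ ⟨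
      d * (∣ P ∣ + ∣ Q ∣)                          ≡⟨ cong (d *_) (∣p∪q∣+∣p∩q∣≡∣p∣+∣q∣ P Q) ⟨
      d * (∣ P ∪ Q ∣ + ∣ P ∩ Q ∣)                  ≡⟨ *-distribˡ-+ d ∣ P ∪ Q ∣ ∣ P ∩ Q ∣ ⟩
      d * ∣ P ∪ Q ∣ + d * ∣ P ∩ Q ∣                ≤⟨ +-mono-≤ (hall (P ∪ Q) P∪Q⊆A) (hall (P ∩ Q) (P⊆A ∘ p∩q⊆p P Q)) ⟩
      ∣ cover F (P ∪ Q) ∣ + ∣ cover F (P ∩ Q) ∣    ≤⟨ +-mono-≤ (p⊆q⇒∣p∣≤∣q∣ union) (p⊆q⇒∣p∣≤∣q∣ intersection) ⟩
      ∣ ⁅ x ⁆ ∪ (Cᵤ ∪ Cᵥ) ∣ + ∣ Cᵤ ∩ Cᵥ ∣          ≤⟨ +-monoˡ-≤ _ (∣p∪q∣≤∣p∣+∣q∣ ⁅ x ⁆ (Cᵤ ∪ Cᵥ)) ⟩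
      ∣ ⁅ x ⁆ ∣ + ∣ Cᵤ ∪ Cᵥ ∣ + ∣ Cᵤ ∩ Cᵥ ∣        ≡⟨ cong (λ i → i + ∣ Cᵤ ∪ Cᵥ ∣ + ∣ Cᵤ ∩ Cᵥ ∣) (∣⁅x⁆∣≡1 x) ⟩
      suc (∣ Cᵤ ∪ Cᵥ ∣ + ∣ Cᵤ ∩ Cᵥ ∣)              ≡⟨ cong suc (∣p∪q∣+∣p∩q∣≡∣p∣+∣q∣ Cᵤ Cᵥ) ⟩
      suc (∣ Cᵤ ∣ + ∣ Cᵥ ∣)                        ∎)
    where
    open ≤-Reasoning
    Cᵤ = cover (delete F u x) P
    Cᵥ = cover (delete F v x) Q
    v∉P : v ∉ P
    v∉P = violator-avoids F hall u≢v x∈Fv violP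
    u∉Q : u ∉ Q
    u∉Q = violator-avoids F hall (u≢v ∘ sym) x∈Fu violQ
    P∪Q⊆A : P ∪ Q ⊆ A
    P∪Q⊆A w∈ with x∈p∪q⁻ P Q w∈
    ... | inj₁ w∈P = P⊆A w∈P
    ... | inj₂ w∈Q = Q⊆A w∈Q
    union : cover F (P ∪ Q) ⊆ ⁅ x ⁆ ∪ (Cᵤ ∪ Cᵥ)
    union {y} y∈ with y Fin.≟ x
    ... | yes refl = p⊆p∪q (Cᵤ ∪ Cᵥ) (x∈⁅x⁆ x)
    ... | no  y≢x with ∈-cover⁻ F (P ∪ Q) y∈
    ...   | w , w∈P∪Q , y∈Fw with x∈p∪q⁻ P Q w∈P∪Q
    ...     | inj₁ w∈P = q⊆p∪q ⁅ x ⁆ _ (p⊆p∪q Cᵥ (∈-cover⁺ _ w∈P (∈-delete F (y≢x ∘ proj₂) y∈Fw)))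
    ...     | inj₂ w∈Q = q⊆p∪q ⁅ x ⁆ _ (q⊆p∪q Cᵤ Cᵥ (∈-cover⁺ _ w∈Q (∈-delete F (y≢x ∘ proj₂) y∈Fw)))
    intersection : cover F (P ∩ Q) ⊆ Cᵤ ∩ Cᵥ
    intersection y∈ with ∈-cover⁻ F (P ∩ Q) y∈
    ... | w , w∈P∩Q , y∈Fw with x∈p∩q⁻ P Q w∈P∩Q
    ...   | w∈P , w∈Q = x∈p∩q⁺
      ( ∈-cover⁺ _ w∈P (∈-delete F (λ (w≡u , _) → u∉Q (subst (_∈ Q) w≡u w∈Q)) y∈Fw)
      , ∈-cover⁺ _ w∈Q (∈-delete F (λ (w≡v , _) → v∉P (subst (_∈ P) w≡v w∈P)) y∈Fw))

  Private : (F P : Fin m → Subset s) → Set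
  Private F P = (∀ u → P u ⊆ F u) × (∀ {u} → u ∈ A → d ≤ ∣ P u ∣)
              × (∀ {u v x} → u ∈ A → v ∈ A → x ∈ P u → x ∈ P v → u ≡ v)

  -- While two members of A share an address, it can be deleted from one of them without losing
  -- Hall's condition; the total size of the family decreases. At the end the sets are disjoint on
  -- A, and Hall's condition for singletons yields d addresses for each member.
  private-neighbours : ∀ (F : Fin m → Subset s) → Hall F → ∃ (Private F)
  private-neighbours {s} F = go F (<-wellFounded _)
    where
    size : (Fin m → Subset s) → ℕ
    size F = ∑[ u ∈ allFin m ] ∣ F u ∣

    size-delete : ∀ F {u x} → x ∈ F u → size (delete F u x) < size F
    size-delete F {u} {x} x∈Fu =
      ∑-mono-< (allFin m) (λ v → p⊆q⇒∣p∣≤∣q∣ (delete-⊆ F u x v)) (∈-allFin u) (∣delete∣< F u x∈Fu)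

    conflict? : ∀ (F : Fin m → Subset s) → Dec (∃ λ u → ∃ λ v → ∃ λ x → u ∈ A × v ∈ A × u ≢ v × x ∈ F u × x ∈ F v)
    conflict? F = any? λ u → any? λ v → any? λ x →
      (u ∈? A) ×-dec (v ∈? A) ×-dec ¬? (u Fin.≟ v) ×-dec (x ∈? F u) ×-dec (x ∈? F v)

    go : ∀ F → Acc _<_ (size F) → Hall F → ∃ (Private F)

    shrink : ∀ F → Acc _<_ (size F) → ∀ {u x} → x ∈ F u → Hall (delete F u x) → ∃ (Private F)
    shrink F (acc rec) {u} {x} x∈Fu hall with go (delete F u x) (rec (size-delete F x∈Fu)) hall
    ... | P , P⊆ , d≤ , disjoint = P , (λ v → delete-⊆ F u x v ∘ P⊆ v) , d≤ , disjoint

    go F ac hall with conflict? F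
    ... | yes (u , v , x , u∈A , v∈A , u≢v , x∈Fu , x∈Fv)
            with hall⊎violator (delete F u x) | hall⊎violator (delete F v x)
    ...   | inj₁ hallᵤ       | _                = shrink F ac x∈Fu hallᵤ
    ...   | inj₂ _           | inj₁ hallᵥ       = shrink F ac x∈Fv hallᵥ
    ...   | inj₂ (P , violP) | inj₂ (Q , violQ) =
      ⊥-elim (no-two-violators F hall u≢v x∈Fu x∈Fv violP violQ)
    go F ac hall | no none = F , (λ u → id) , large , disjoint
      where
      large : ∀ {u} → u ∈ A → d ≤ ∣ F u ∣
      large {u} u∈A = begin
        d                     ≡⟨ trans (cong (d *_) (∣⁅x⁆∣≡1 u)) (*-identityʳ d) ⟨
        d * ∣ ⁅ u ⁆ ∣         ≤⟨ hall ⁅ u ⁆ (λ w∈ → subst (_∈ A) (sym (x∈⁅y⁆⇒x≡y u w∈)) u∈A) ⟩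
        ∣ cover F ⁅ u ⁆ ∣     ≤⟨ p⊆q⇒∣p∣≤∣q∣ single ⟩
        ∣ F u ∣               ∎
        where
        open ≤-Reasoning
        single : cover F ⁅ u ⁆ ⊆ F u
        single x∈ with ∈-cover⁻ F ⁅ u ⁆ x∈
        ... | w , w∈ , x∈Fw = subst (λ w → _ ∈ F w) (x∈⁅y⁆⇒x≡y u w∈) x∈Fw
      disjoint : ∀ {u v x} → u ∈ A → v ∈ A → x ∈ F u → x ∈ F v → u ≡ v
      disjoint {u} {v} {x} u∈A v∈A x∈Fu x∈Fv with u Fin.≟ v
      ... | yes u≡v = u≡v
      ... | no  u≢v = ⊥-elim (none (u , v , x , u∈A , v∈A , u≢v , x∈Fu , x∈Fv))

-- Exponential moment of the number of exceptional elements

∣nbrs∣≤ : ∀ {L} (r : Vec (Fin s) L) → ∣ nbrs r ∣ ≤ L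
∣nbrs∣≤ {s} []      = ≤-reflexive (∣⊥∣≡0 s)
∣nbrs∣≤     (x ∷ r) = ≤-trans (∣p∪q∣≤∣p∣+∣q∣ ⁅ x ⁆ (nbrs r)) (+-mono-≤ (≤-reflexive (∣⁅x⁆∣≡1 x)) (∣nbrs∣≤ r))

∣N∣≤ : ∀ {L} (G : Vec (Vec (Fin s) L) m) S → ∣ N G S ∣ ≤ L * ∣ S ∣
∣N∣≤ {s} {L = L} []      []          = ≤-trans (≤-reflexive (∣⊥∣≡0 s)) z≤n
∣N∣≤ {L = L}     (r ∷ G) (true  ∷ S) = ≤-trans (∣p∪q∣≤∣p∣+∣q∣ (nbrs r) (N G S))
  (≤-trans (+-mono-≤ (∣nbrs∣≤ r) (∣N∣≤ G S)) (≤-reflexive (sym (*-suc L ∣ S ∣))))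
∣N∣≤             (r ∷ G) (false ∷ S) = ∣N∣≤ G S

-- Positions are counted, not distinct addresses: a row may repeat an address, and the majority vote
-- counts each repetition.
hits : ∀ {L} → Vec (Fin s) L → Subset s → ℕ
hits []      W = 0
hits (x ∷ r) W = 𝟙 (x ∈? W) + hits r W

-- A union bound over the j positions that hit W: at most 2^L choices, each of probability
-- (∣W∣/s)^j. The recursion on the first probe follows Pascal's rule.
#rows-with-hits : ∀ (W : Subset s) L j →
  (∑[ r ∈ rows s L ] 𝟙 (j ≤? hits r W)) * s ^ j ≤ 2 ^ L * ∣ W ∣ ^ j * s ^ L
#rows-with-hits {s} W L zero = begin
  (∑[ r ∈ rows s L ] 1) * 1    ≡⟨ *-identityʳ _ ⟩
  ∑[ r ∈ rows s L ] 1          ≡⟨ trans (∑-const (rows s L) 1) (*-identityʳ _) ⟩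
  length (rows s L)            ≡⟨ length-rows s L ⟩
  s ^ L                        ≤⟨ m≤n*m (s ^ L) (2 ^ L * 1) ⦃ m*n≢0 (2 ^ L) 1 ⦃ m^n≢0 2 L ⦄ ⦄ ⟩
  2 ^ L * 1 * s ^ L            ∎
  where open ≤-Reasoning
#rows-with-hits {s} W zero    (suc j) = z≤n
#rows-with-hits {s} W (suc L) (suc j) = begin
  (∑[ r ∈ rows s (suc L) ] 𝟙 (suc j ≤? hits r W)) * s ^ suc j
    ≡⟨ cong (_* s ^ suc j) (∑-vecs (allFin s) L _) ⟩
  (∑[ x ∈ allFin s ] ∑[ r ∈ rows s L ] 𝟙 (suc j ≤? 𝟙 (x ∈? W) + hits r W)) * s ^ suc j
    ≤⟨ *-monoˡ-≤ (s ^ suc j) (∑-mono (allFin s) each) ⟩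
  (∑[ x ∈ allFin s ] (𝟙 (x ∈? W) * g j + g (suc j))) * s ^ suc j
    ≡⟨ cong (_* s ^ suc j) (trans (∑-+ (allFin s) _ _) (cong₂ _+_
         (trans (∑-*ʳ (allFin s) (g j) _) (cong (_* g j) (∑-∈ W)))
         (trans (∑-const (allFin s) (g (suc j))) (cong (_* g (suc j)) (length-tabulate {n = s} id))))) ⟩
  (∣ W ∣ * g j + s * g (suc j)) * (s * s ^ j)
    ≡⟨ shuffle₁ ∣ W ∣ (g j) s (g (suc j)) (s ^ j) ⟩
  ∣ W ∣ * s * (g j * s ^ j) + s * (g (suc j) * (s * s ^ j))
    ≤⟨ +-mono-≤ (*-monoʳ-≤ (∣ W ∣ * s) (#rows-with-hits W L j)) (*-monoʳ-≤ s (#rows-with-hits W L (suc j))) ⟩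
  ∣ W ∣ * s * (2 ^ L * ∣ W ∣ ^ j * s ^ L) + s * (2 ^ L * (∣ W ∣ * ∣ W ∣ ^ j) * s ^ L)
    ≡⟨ shuffle₂ ∣ W ∣ s (2 ^ L) (∣ W ∣ ^ j) (s ^ L) ⟩
  2 * 2 ^ L * (∣ W ∣ * ∣ W ∣ ^ j) * (s * s ^ L)
    ∎
  where
  open ≤-Reasoning
  g : ℕ → ℕ
  g i = ∑[ r ∈ rows s L ] 𝟙 (i ≤? hits r W)
  each : ∀ x → ∑[ r ∈ rows s L ] 𝟙 (suc j ≤? 𝟙 (x ∈? W) + hits r W) ≤ 𝟙 (x ∈? W) * g j + g (suc j)
  each x with x ∈? W
  ... | no  _ = ≤-refl
  ... | yes _ = ≤-trans (∑-mono (rows s L) λ r → 𝟙-mono (suc j ≤? suc (hits r W)) (j ≤? hits r W) s≤s⁻¹)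
                  (≤-trans (≤-reflexive (sym (+-identityʳ (g j)))) (m≤m+n _ (g (suc j))))
  shuffle₁ : ∀ w a s b p → (w * a + s * b) * (s * p) ≡ w * s * (a * p) + s * (b * (s * p))
  shuffle₁ = solve-∀
  shuffle₂ : ∀ w s x p q → w * s * (x * p * q) + s * (x * (w * p) * q) ≡ 2 * x * (w * p) * (s * q)
  shuffle₂ = solve-∀

module _ {s t : ℕ} where

  private
    Row = Vec (Fin s) t
    ρ   = length (rows s t)

  -- `W` is a separate argument although the intended value is `N G S`: for a frozen W, each row
  -- outside S decides membership on its own.
  excess : ℕ → Subset s → Subset m → Vec Row m → Subset m
  excess d W []          []      = []
  excess d W (true  ∷ S) (r ∷ G) = outside ∷ excess d W S G
  excess d W (false ∷ S) (r ∷ G) = does (d ≤? hits r W) ∷ excess d W S G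

  merge : Subset m → Vec Row m → Vec Row m → Vec Row m
  merge []          []      []      = []
  merge (true  ∷ S) (h ∷ H) (g ∷ G) = h ∷ merge S H G
  merge (false ∷ S) (h ∷ H) (g ∷ G) = g ∷ merge S H G

  N-merge : ∀ (S : Subset m) H G → N (merge S H G) S ≡ N H S
  N-merge []          []      []      = refl
  N-merge (true  ∷ S) (h ∷ H) (g ∷ G) = cong (nbrs h ∪_) (N-merge S H G)
  N-merge (false ∷ S) (h ∷ H) (g ∷ G) = N-merge S H G

  excess-merge : ∀ d W (S : Subset m) H G → excess d W S (merge S H G) ≡ excess d W S G
  excess-merge d W []          []      []      = refl
  excess-merge d W (true  ∷ S) (h ∷ H) (g ∷ G) = cong (outside ∷_) (excess-merge d W S H G)
  excess-merge d W (false ∷ S) (h ∷ H) (g ∷ G) = cong (_ ∷_) (excess-merge d W S H G)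

  -- The rows of H outside S and those of G inside S are lost, so each table arises from exactly ρ^m
  -- pairs: merging two independent uniform tables gives a uniform one.
  ∑-merge : ∀ (S : Subset m) (f : Vec Row m → ℕ) →
    ∑[ H ∈ tables m s t ] ∑[ G ∈ tables m s t ] f (merge S H G) ≡ ρ ^ m * ∑ (tables m s t) f
  ∑-merge [] f = refl
  ∑-merge {suc m} (true ∷ S) f = begin
    ∑[ H ∈ tables (suc m) s t ] ∑[ G ∈ tables (suc m) s t ] f (merge (true ∷ S) H G)
      ≡⟨ ∑-vecs (rows s t) m _ ⟩
    ∑[ h ∈ rows s t ] ∑[ H ∈ tables m s t ] ∑[ G ∈ tables (suc m) s t ] f (merge (true ∷ S) (h ∷ H) G)
      ≡⟨ ∑-cong (rows s t) (λ h → trans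
           (∑-cong (tables m s t) λ H → trans (∑-vecs (rows s t) m _) (∑-const (rows s t) _))
           (trans (∑-*ˡ (tables m s t) ρ _) (cong (ρ *_) (∑-merge S (f ∘ (h ∷_)))))) ⟩
    ∑[ h ∈ rows s t ] (ρ * (ρ ^ m * ∑ (tables m s t) (f ∘ (h ∷_))))
      ≡⟨ ∑-cong (rows s t) (λ h → sym (*-assoc ρ (ρ ^ m) _)) ⟩
    ∑[ h ∈ rows s t ] (ρ * ρ ^ m * ∑ (tables m s t) (f ∘ (h ∷_)))
      ≡⟨ ∑-*ˡ (rows s t) (ρ * ρ ^ m) _ ⟩
    ρ * ρ ^ m * (∑[ h ∈ rows s t ] ∑ (tables m s t) (f ∘ (h ∷_)))
      ≡⟨ cong (ρ * ρ ^ m *_) (sym (∑-vecs (rows s t) m f)) ⟩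
    ρ * ρ ^ m * ∑ (tables (suc m) s t) f
      ∎
    where open ≡-Reasoning
  ∑-merge {suc m} (false ∷ S) f = begin
    ∑[ H ∈ tables (suc m) s t ] ∑[ G ∈ tables (suc m) s t ] f (merge (false ∷ S) H G)
      ≡⟨ ∑-vecs (rows s t) m _ ⟩
    ∑[ h ∈ rows s t ] ∑[ H ∈ tables m s t ] ∑[ G ∈ tables (suc m) s t ] f (merge (false ∷ S) (h ∷ H) G)
      ≡⟨ ∑-cong (rows s t) (λ h → ∑-cong (tables m s t) λ H → ∑-vecs (rows s t) m _) ⟩
    ∑[ h ∈ rows s t ] ∑[ H ∈ tables m s t ] ∑[ g ∈ rows s t ] ∑[ G ∈ tables m s t ] f (g ∷ merge S H G)
      ≡⟨ ∑-const (rows s t) _ ⟩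
    ρ * (∑[ H ∈ tables m s t ] ∑[ g ∈ rows s t ] ∑[ G ∈ tables m s t ] f (g ∷ merge S H G))
      ≡⟨ cong (ρ *_) (trans (∑-comm (tables m s t) (rows s t) _)
           (trans (∑-cong (rows s t) λ g → ∑-merge S (f ∘ (g ∷_))) (∑-*ˡ (rows s t) (ρ ^ m) _))) ⟩
    ρ * (ρ ^ m * (∑[ g ∈ rows s t ] ∑ (tables m s t) (f ∘ (g ∷_))))
      ≡⟨ cong (λ x → ρ * (ρ ^ m * x)) (sym (∑-vecs (rows s t) m f)) ⟩
    ρ * (ρ ^ m * ∑ (tables (suc m) s t) f)
      ≡⟨ *-assoc ρ (ρ ^ m) _ ⟨
    ρ * ρ ^ m * ∑ (tables (suc m) s t) f
      ∎
    where open ≡-Reasoning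

  -- By independence the moment is a product. An element outside S contributes 1 plus the
  -- probability of at least d hits; a member of S contributes 1, which is enlarged to the same
  -- factor so that the bound does not depend on ∣S∣.
  ∑-2^excess : ∀ d W (S : Subset m) →
    ∑[ G ∈ tables m s t ] 2 ^ ∣ excess d W S G ∣ ≤ (ρ + (∑[ r ∈ rows s t ] 𝟙 (d ≤? hits r W))) ^ m
  ∑-2^excess d W []          = ≤-refl
  ∑-2^excess {suc m} d W (true ∷ S) = begin
    ∑[ G ∈ tables (suc m) s t ] 2 ^ ∣ excess d W (true ∷ S) G ∣
      ≡⟨ trans (∑-vecs (rows s t) m _) (∑-const (rows s t) _) ⟩
    ρ * (∑[ G ∈ tables m s t ] 2 ^ ∣ excess d W S G ∣)
      ≤⟨ *-mono-≤ (m≤m+n ρ _) (∑-2^excess d W S) ⟩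
    (ρ + (∑[ r ∈ rows s t ] 𝟙 (d ≤? hits r W))) ^ suc m
      ∎
    where open ≤-Reasoning
  ∑-2^excess {suc m} d W (false ∷ S) = begin
    ∑[ G ∈ tables (suc m) s t ] 2 ^ ∣ excess d W (false ∷ S) G ∣
      ≡⟨ ∑-vecs (rows s t) m _ ⟩
    ∑[ r ∈ rows s t ] ∑[ G ∈ tables m s t ] 2 ^ ∣ does (d ≤? hits r W) ∷ excess d W S G ∣
      ≡⟨ ∑-cong (rows s t) (λ r → trans
           (∑-cong (tables m s t) λ G → 2^∣b∷p∣ (d ≤? hits r W) (excess d W S G))
           (∑-*ˡ (tables m s t) (1 + 𝟙 (d ≤? hits r W)) _)) ⟩
    ∑[ r ∈ rows s t ] ((1 + 𝟙 (d ≤? hits r W)) * e)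
      ≡⟨ trans (∑-*ʳ (rows s t) e _) (cong (_* e) (trans (∑-+ (rows s t) (λ _ → 1) _)
           (cong (_+ β) (trans (∑-const (rows s t) 1) (*-identityʳ ρ))))) ⟩
    (ρ + β) * e
      ≤⟨ *-monoʳ-≤ (ρ + β) (∑-2^excess d W S) ⟩
    (ρ + β) ^ suc m
      ∎
    where
    open ≤-Reasoning
    β = ∑[ r ∈ rows s t ] 𝟙 (d ≤? hits r W)
    e = ∑[ G ∈ tables m s t ] 2 ^ ∣ excess d W S G ∣
    2^∣b∷p∣ : ∀ {P : Set} (P? : Dec P) (p : Subset m) → 2 ^ ∣ does P? ∷ p ∣ ≡ (1 + 𝟙 P?) * 2 ^ ∣ p ∣
    2^∣b∷p∣ (yes _) p = refl
    2^∣b∷p∣ (no _)  p = sym (+-identityʳ _)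

  #tables≢0 : .⦃ _ : NonZero s ⦄ → ∀ m → NonZero (ρ ^ m)
  #tables≢0 m = m^n≢0 ρ m ⦃ subst NonZero (sym (length-rows s t)) (m^n≢0 s t) ⦄

  module _ .⦃ _ : NonZero s ⦄ (m d z n : ℕ) .⦃ _ : NonZero z ⦄
           (m≤zn : m ≤ z * n) (sparse : z * (2 ^ t * (t * n) ^ d) ≤ s ^ d) where

    private
      Ω = ρ ^ m

    #hits*z≤ : ∀ W → ∣ W ∣ ≤ t * n → (∑[ r ∈ rows s t ] 𝟙 (d ≤? hits r W)) * z ≤ ρ
    #hits*z≤ W ∣W∣≤ = *-cancelʳ-≤ _ _ (s ^ d) ⦃ m^n≢0 s d ⦄ (begin
      β * z * s ^ d                      ≡⟨ shuffle₁ β z (s ^ d) ⟩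
      z * (β * s ^ d)                    ≤⟨ *-monoʳ-≤ z (#rows-with-hits W t d) ⟩
      z * (2 ^ t * ∣ W ∣ ^ d * s ^ t)    ≤⟨ *-monoʳ-≤ z (*-monoˡ-≤ (s ^ t) (*-monoʳ-≤ (2 ^ t) (^-monoˡ-≤ d ∣W∣≤))) ⟩
      z * (2 ^ t * (t * n) ^ d * s ^ t)  ≡⟨ shuffle₂ z (2 ^ t * (t * n) ^ d) (s ^ t) ⟩
      s ^ t * (z * (2 ^ t * (t * n) ^ d)) ≤⟨ *-monoʳ-≤ (s ^ t) sparse ⟩
      s ^ t * s ^ d                      ≡⟨ cong (_* s ^ d) (sym (length-rows s t)) ⟩
      ρ * s ^ d                          ∎)
      where
      open ≤-Reasoning
      β = ∑[ r ∈ rows s t ] 𝟙 (d ≤? hits r W)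
      shuffle₁ : ∀ a b c → a * b * c ≡ b * (a * c)
      shuffle₁ = solve-∀
      shuffle₂ : ∀ a b c → a * (b * c) ≡ c * (a * b)
      shuffle₂ = solve-∀

    ∑-2^excess≤ : ∀ W (S : Subset m) → ∣ W ∣ ≤ t * n → ∑[ G ∈ tables m s t ] 2 ^ ∣ excess d W S G ∣ ≤ 4 ^ n * Ω
    ∑-2^excess≤ W S ∣W∣≤ = *-cancelʳ-≤ _ _ (z ^ m) ⦃ m^n≢0 z m ⦄ (begin
      (∑[ G ∈ tables m s t ] 2 ^ ∣ excess d W S G ∣) * z ^ m  ≤⟨ *-monoˡ-≤ (z ^ m) (∑-2^excess d W S) ⟩
      (ρ + β) ^ m * z ^ m          ≡⟨ ^-distribʳ-* (ρ + β) z m ⟨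
      ((ρ + β) * z) ^ m            ≤⟨ ^-monoˡ-≤ m (begin
        (ρ + β) * z                  ≡⟨ *-distribʳ-+ z ρ β ⟩
        ρ * z + β * z                ≤⟨ +-monoʳ-≤ (ρ * z) (#hits*z≤ W ∣W∣≤) ⟩
        ρ * z + ρ                    ≡⟨ +-comm (ρ * z) ρ ⟩
        ρ + ρ * z                    ≡⟨ *-suc ρ z ⟨
        ρ * suc z                    ∎) ⟩
      (ρ * suc z) ^ m              ≡⟨ ^-distribʳ-* ρ (suc z) m ⟩
      Ω * suc z ^ m                ≤⟨ *-monoʳ-≤ Ω (suc^≤4^*^ z n m m≤zn) ⟩
      Ω * (4 ^ n * z ^ m)          ≡⟨ shuffle Ω (4 ^ n) (z ^ m) ⟩
      4 ^ n * Ω * z ^ m            ∎)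
      where
      open ≤-Reasoning
      β = ∑[ r ∈ rows s t ] 𝟙 (d ≤? hits r W)
      shuffle : ∀ a b c → a * (b * c) ≡ b * a * c
      shuffle = solve-∀

    -- The rows inside S and those outside S are resampled independently.
    ∑-2^excess-N : ∀ (S : Subset m) → ∣ S ∣ ≤ n →
      ∑[ G ∈ tables m s t ] 2 ^ ∣ excess d (N G S) S G ∣ ≤ 4 ^ n * Ω
    ∑-2^excess-N S ∣S∣≤n = *-cancelˡ-≤ Ω ⦃ #tables≢0 m ⦄ (begin
      Ω * (∑[ G ∈ tables m s t ] 2 ^ ∣ excess d (N G S) S G ∣)
        ≡⟨ ∑-merge S _ ⟨
      ∑[ H ∈ tables m s t ] ∑[ G ∈ tables m s t ] 2 ^ ∣ excess d (N (merge S H G) S) S (merge S H G) ∣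
        ≡⟨ ∑-cong (tables m s t) (λ H → ∑-cong (tables m s t) λ G → cong (λ p → 2 ^ ∣ p ∣)
             (trans (cong (λ W → excess d W S (merge S H G)) (N-merge S H G)) (excess-merge d (N H S) S H G))) ⟩
      ∑[ H ∈ tables m s t ] ∑[ G ∈ tables m s t ] 2 ^ ∣ excess d (N H S) S G ∣
        ≤⟨ ∑-mono (tables m s t) (λ H → ∑-2^excess≤ (N H S) S (≤-trans (∣N∣≤ H S) (*-monoʳ-≤ t ∣S∣≤n))) ⟩
      ∑[ H ∈ tables m s t ] (4 ^ n * Ω)
        ≡⟨ ∑-const (tables m s t) _ ⟩
      length (tables m s t) * (4 ^ n * Ω)
        ≡⟨ cong (_* (4 ^ n * Ω)) (length-vecs (rows s t) m) ⟩
      Ω * (4 ^ n * Ω)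
        ∎)
      where open ≤-Reasoning

    -- Markov's inequality for 2^excess, summed over S. The moment 4^n and the number (4z)^n of sets
    -- S multiply to (16z)^n, while 2^(r n) ≥ (64z)^n; the quotient 4^(-n) is at most 1/4 because n
    -- ≥ 1.
    #large-excess : ∀ r → 1 ≤ n → 64 * z ≤ 2 ^ r →
      4 * (∑[ S ∈ subsets m ] (𝟙 (∣ S ∣ ≤? n) *
        (∑[ G ∈ tables m s t ] 𝟙 (r * n ≤? ∣ excess d (N G S) S G ∣)))) ≤ Ω
    #large-excess r 1≤n 64z≤2^r = *-cancelʳ-≤ _ _ ((16 * z) ^ n * z ^ m)
      ⦃ m*n≢0 _ _ ⦃ m^n≢0 (16 * z) n ⦃ m*n≢0 16 z ⦄ ⦄ ⦃ m^n≢0 z m ⦄ ⦄ (begin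
      4 * E * ((16 * z) ^ n * z ^ m)
        ≤⟨ *-monoˡ-≤ ((16 * z) ^ n * z ^ m) (*-monoˡ-≤ E (m≤m^n 4 1≤n)) ⟩
      4 ^ n * E * ((16 * z) ^ n * z ^ m)
        ≡⟨ shuffle₁ (4 ^ n) E ((16 * z) ^ n) (z ^ m) ⟩
      4 ^ n * (16 * z) ^ n * (E * z ^ m)
        ≡⟨ cong (_* (E * z ^ m)) (trans (sym (^-distribʳ-* 4 (16 * z) n)) (cong (_^ n) (sym (*-assoc 4 16 z)))) ⟩
      (64 * z) ^ n * (E * z ^ m)
        ≤⟨ *-monoˡ-≤ (E * z ^ m) (≤-trans (^-monoˡ-≤ n 64z≤2^r) (≤-reflexive (^-*-assoc 2 r n))) ⟩
      2 ^ (r * n) * (E * z ^ m)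
        ≡⟨ shuffle₂ (2 ^ (r * n)) E (z ^ m) ⟩
      E * 2 ^ (r * n) * z ^ m
        ≡⟨ cong (_* z ^ m) (∑-*ʳ (subsets m) (2 ^ (r * n)) _) ⟨
      (∑[ S ∈ subsets m ] (𝟙 (∣ S ∣ ≤? n) * e S * 2 ^ (r * n))) * z ^ m
        ≤⟨ *-monoˡ-≤ (z ^ m) (∑-mono (subsets m) markov) ⟩
      (∑[ S ∈ subsets m ] (𝟙 (∣ S ∣ ≤? n) * (4 ^ n * Ω))) * z ^ m
        ≡⟨ cong (_* z ^ m) (∑-*ʳ (subsets m) (4 ^ n * Ω) _) ⟩
      #S * (4 ^ n * Ω) * z ^ m
        ≡⟨ shuffle₃ #S (4 ^ n * Ω) (z ^ m) ⟩
      4 ^ n * Ω * (#S * z ^ m)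
        ≤⟨ *-monoʳ-≤ (4 ^ n * Ω) (#subsets-of-size≤ m z n) ⟩
      4 ^ n * Ω * (z ^ n * suc z ^ m)
        ≤⟨ *-monoʳ-≤ (4 ^ n * Ω) (*-monoʳ-≤ (z ^ n) (suc^≤4^*^ z n m m≤zn)) ⟩
      4 ^ n * Ω * (z ^ n * (4 ^ n * z ^ m))
        ≡⟨ shuffle₄ (4 ^ n) Ω (z ^ n) (z ^ m) ⟩
      Ω * (4 ^ n * 4 ^ n * z ^ n * z ^ m)
        ≡⟨ cong (λ x → Ω * (x * z ^ m)) (trans
             (cong (_* z ^ n) (sym (^-distribʳ-* 4 4 n))) (sym (^-distribʳ-* 16 z n))) ⟩
      Ω * ((16 * z) ^ n * z ^ m)
        ∎)
      where
      open ≤-Reasoning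
      e : Subset m → ℕ
      e S = ∑[ G ∈ tables m s t ] 𝟙 (r * n ≤? ∣ excess d (N G S) S G ∣)
      E  = ∑[ S ∈ subsets m ] (𝟙 (∣ S ∣ ≤? n) * e S)
      #S = ∑[ S ∈ subsets m ] 𝟙 (∣ S ∣ ≤? n)
      m≤m^n : ∀ m .⦃ _ : NonZero m ⦄ {n} → 1 ≤ n → m ≤ m ^ n
      m≤m^n m {suc n} _ = m≤m*n m (m ^ n) ⦃ m^n≢0 m n ⦄
      tail : ∀ i → 𝟙 (r * n ≤? i) * 2 ^ (r * n) ≤ 2 ^ i
      tail i = ≤-trans (𝟙-*-monoʳ-≤ (r * n ≤? i) (^-monoʳ-≤ 2))
        (≤-trans (*-monoˡ-≤ (2 ^ i) (𝟙≤1 (r * n ≤? i))) (≤-reflexive (*-identityˡ (2 ^ i))))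
      markov : ∀ S → 𝟙 (∣ S ∣ ≤? n) * e S * 2 ^ (r * n) ≤ 𝟙 (∣ S ∣ ≤? n) * (4 ^ n * Ω)
      markov S = begin
        𝟙 (∣ S ∣ ≤? n) * e S * 2 ^ (r * n)     ≡⟨ *-assoc (𝟙 (∣ S ∣ ≤? n)) (e S) _ ⟩
        𝟙 (∣ S ∣ ≤? n) * (e S * 2 ^ (r * n))   ≤⟨ 𝟙-*-monoʳ-≤ (∣ S ∣ ≤? n) (λ ∣S∣≤n → begin
          e S * 2 ^ (r * n)         ≡⟨ ∑-*ʳ (tables m s t) (2 ^ (r * n)) _ ⟨
          ∑[ G ∈ tables m s t ] (𝟙 (r * n ≤? ∣ excess d (N G S) S G ∣) * 2 ^ (r * n))
            ≤⟨ ∑-mono (tables m s t) (λ G → tail ∣ excess d (N G S) S G ∣) ⟩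
          ∑[ G ∈ tables m s t ] 2 ^ ∣ excess d (N G S) S G ∣
            ≤⟨ ∑-2^excess-N S ∣S∣≤n ⟩
          4 ^ n * Ω                 ∎) ⟩
        𝟙 (∣ S ∣ ≤? n) * (4 ^ n * Ω)           ∎
      shuffle₁ : ∀ a b c d → a * b * (c * d) ≡ a * c * (b * d)
      shuffle₁ = solve-∀
      shuffle₂ : ∀ a b c → a * (b * c) ≡ b * a * c
      shuffle₂ = solve-∀
      shuffle₃ : ∀ a b c → a * b * c ≡ b * (a * c)
      shuffle₃ = solve-∀
      shuffle₄ : ∀ f o z q → f * o * (z * (f * q)) ≡ o * (f * f * z * q)
      shuffle₄ = solve-∀

-- Tables of rows that serve every stored set

Good : ∀ {m s t} (d n R : ℕ) → Vec (Vec (Fin s) t) m → Set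
Good d n R G = (∀ A → 1 ≤ ∣ A ∣ → ∣ A ∣ ≤ n + R → d * ∣ A ∣ < ∣ N G A ∣)
             × (∀ S → ∣ S ∣ ≤ n → ∣ excess d (N G S) S G ∣ < R)

third+quarter<one : ∀ a b c → 0 < c → 3 * a ≤ c → 4 * b ≤ c → a + b < c
third+quarter<one a b c 0<c 3a≤c 4b≤c = *-cancelˡ-< 12 _ _ (begin-strict
  12 * (a + b)                  ≡⟨ shuffle₁ a b ⟩
  4 * (3 * a) + 3 * (4 * b)     ≤⟨ +-mono-≤ (*-monoʳ-≤ 4 3a≤c) (*-monoʳ-≤ 3 4b≤c) ⟩
  4 * c + 3 * c                 ≡⟨ shuffle₂ c ⟩
  7 * c                         <⟨ *-monoˡ-< c ⦃ >-nonZero 0<c ⦄ (m≤m+n 8 4) ⟩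
  12 * c                        ∎)
  where
  open ≤-Reasoning
  shuffle₁ : ∀ a b → 12 * (a + b) ≡ 4 * (3 * a) + 3 * (4 * b)
  shuffle₁ = solve-∀
  shuffle₂ : ∀ a → 4 * a + 3 * a ≡ 7 * a
  shuffle₂ = solve-∀

∃-good : ∀ m s .⦃ _ : NonZero s ⦄ κ d .⦃ _ : NonZero d ⦄ n z .⦃ _ : NonZero z ⦄ r →
  let k = suc κ ; t = k + d ; R = r * n in
  1 ≤ n → m ≤ z * n → 64 * z ≤ 2 ^ r →
  16 * (2 ^ t * (d ^ k * (m * (n + R) ^ κ))) ≤ s ^ k →
  z * (2 ^ t * (t * n) ^ d) ≤ s ^ d →
  ∃ λ (G : Vec (Vec (Fin s) t) m) → Good d n R G
∃-good m s κ d n z r 1≤n m≤zn 64z≤2^r large sparse =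
  extract (∑<length⇒∃≡0 (tables m s t) (λ G → smalls G + wide G) total)
  where
  open ≤-Reasoning
  k = suc κ
  t = k + d
  R = r * n
  ρ = length (rows s t)
  Ω = ρ ^ m
  -- Index i stands for size i + 1, so the empty set is left out and `upTo (n + R)` ends at size n +
  -- R.
  small : ℕ → Vec (Vec (Fin s) t) m → ℕ
  small i G = ∑[ A ∈ subsets m ] (𝟙 (∣ A ∣ ≟ suc i) * 𝟙 (∣ N G A ∣ ≤? d * ∣ A ∣))
  smalls wide : Vec (Vec (Fin s) t) m → ℕ
  smalls G = ∑[ i ∈ upTo (n + R) ] small i G
  wide G = ∑[ S ∈ subsets m ] (𝟙 (∣ S ∣ ≤? n) * 𝟙 (R ≤? ∣ excess d (N G S) S G ∣))

  ∑-small : ∀ i → ∑ (tables m s t) (small i)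
    ≡ ∑[ A ∈ subsets m ] (𝟙 (∣ A ∣ ≟ suc i) * (∑[ G ∈ tables m s t ] 𝟙 (∣ N G A ∣ ≤? d * ∣ A ∣)))
  ∑-small i = trans (∑-comm (tables m s t) (subsets m) _)
    (∑-cong (subsets m) λ A → ∑-*ˡ (tables m s t) (𝟙 (∣ A ∣ ≟ suc i)) _)

  3∑smalls≤ : 3 * ∑ (tables m s t) smalls ≤ Ω
  3∑smalls≤ = begin
    3 * ∑ (tables m s t) smalls
      ≡⟨ cong (3 *_) (∑-comm (tables m s t) (upTo (n + R)) (λ G i → small i G)) ⟩
    3 * (∑[ i ∈ upTo (n + R) ] ∑ (tables m s t) (small i))
      ≤⟨ ∑-geometric (n + R) _ Ω (λ i i<n+R → ≤-trans (≤-reflexive (cong (_* 4 ^ suc i) (∑-small i)))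
           (#small-covers-of-size m s κ d (suc i) (≤-trans
             (*-monoʳ-≤ 16 (*-monoʳ-≤ (2 ^ t) (*-monoʳ-≤ (d ^ k) (*-monoʳ-≤ m (^-monoˡ-≤ κ i<n+R))))) large))) ⟩
    Ω ∎

  4∑wide≤ : 4 * ∑ (tables m s t) wide ≤ Ω
  4∑wide≤ = ≤-trans (≤-reflexive (cong (4 *_) (trans (∑-comm (tables m s t) (subsets m) _)
      (∑-cong (subsets m) λ S → ∑-*ˡ (tables m s t) (𝟙 (∣ S ∣ ≤? n)) _))))
    (#large-excess m d z n m≤zn sparse r 1≤n 64z≤2^r)

  0<Ω : 0 < Ω
  0<Ω = >-nonZero⁻¹ Ω ⦃ #tables≢0 {s} {t} m ⦄

  ∑smalls+∑wide<Ω : ∑ (tables m s t) smalls + ∑ (tables m s t) wide < Ω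
  ∑smalls+∑wide<Ω = third+quarter<one (∑ (tables m s t) smalls) (∑ (tables m s t) wide) Ω 0<Ω 3∑smalls≤ 4∑wide≤

  total : ∑[ G ∈ tables m s t ] (smalls G + wide G) < length (tables m s t)
  total = ≤-<-trans (≤-reflexive (∑-+ (tables m s t) smalls wide))
    (<-≤-trans ∑smalls+∑wide<Ω (≤-reflexive (sym (length-vecs (rows s t) m))))

  𝟙*𝟙≡0 : ∀ {P Q : Set} (P? : Dec P) (Q? : Dec Q) → 𝟙 P? * 𝟙 Q? ≡ 0 → P → ¬ Q
  𝟙*𝟙≡0 P? Q? eq p = 𝟙≡0 Q? (trans (sym (*-identityˡ _)) (trans (cong (_* 𝟙 Q?) (sym (𝟙-yes P? p))) eq))

  extract : (∃ λ G → smalls G + wide G ≡ 0) → ∃ λ (G : Vec (Vec (Fin s) t) m) → Good d n R G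
  extract (G , eq) = G , expands , narrow
    where
    narrow : ∀ S → ∣ S ∣ ≤ n → ∣ excess d (N G S) S G ∣ < R
    narrow S ∣S∣≤n = ≰⇒> (𝟙*𝟙≡0 (∣ S ∣ ≤? n) (R ≤? ∣ excess d (N G S) S G ∣)
      (∑≡0⇒≡0 (subsets m) (m+n≡0⇒n≡0 (smalls G) eq) (∈-subsets S)) ∣S∣≤n)
    expands : ∀ A → 1 ≤ ∣ A ∣ → ∣ A ∣ ≤ n + R → d * ∣ A ∣ < ∣ N G A ∣
    expands A 1≤∣A∣ ∣A∣≤n+R = ≰⇒> (𝟙*𝟙≡0 (∣ A ∣ ≟ suc (pred ∣ A ∣)) (∣ N G A ∣ ≤? d * ∣ A ∣)
      (∑≡0⇒≡0 (subsets m) (∑≡0⇒≡0 (upTo (n + R)) (m+n≡0⇒m≡0 (smalls G) eq)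
         (∈-upTo⁺ (subst (_≤ n + R) ∣A∣≡ ∣A∣≤n+R))) (∈-subsets A)) ∣A∣≡)
      where
      ∣A∣≡ : ∣ A ∣ ≡ suc (pred ∣ A ∣)
      ∣A∣≡ = sym (suc-pred ∣ A ∣ ⦃ >-nonZero 1≤∣A∣ ⦄)

-- The majority scheme of a good table

-- The tree stops once enough ones have been read, so its paths differ in length. They all stay
-- among the addresses of the row, and this fixed list witnesses non-adaptivity.
threshold : ∀ {L} → Vec (Fin s) L → ℕ → DTree s
threshold r       zero    = leaf true
threshold []      (suc j) = leaf false
threshold (x ∷ r) (suc j) = node x (threshold r (suc j)) (threshold r j)

depth-threshold : ∀ {L} (r : Vec (Fin s) L) j → depth (threshold r j) ≤ L
depth-threshold r       zero    = z≤n
depth-threshold []      (suc j) = z≤n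
depth-threshold (x ∷ r) (suc j) = s≤s (⊔-lub (depth-threshold r (suc j)) (depth-threshold r j))

probes-threshold : ∀ {L} (r : Vec (Fin s) L) j W {i} → i ∈ˡ probes (threshold r j) W → i ∈ˡ toList r
probes-threshold (x ∷ r) (suc j) W i∈ with lookup W x
probes-threshold (x ∷ r) (suc j) W (here refl) | false = here refl
probes-threshold (x ∷ r) (suc j) W (there i∈)  | false = there (probes-threshold r (suc j) W i∈)
probes-threshold (x ∷ r) (suc j) W (here refl) | true  = here refl
probes-threshold (x ∷ r) (suc j) W (there i∈)  | true  = there (probes-threshold r j W i∈)

-- A `Subset s` is a `Vec Bool s`, so W is both a set of addresses and the stored string: a probe
-- reads true exactly at the members of W.
eval-threshold : ∀ {L} (r : Vec (Fin s) L) j W → eval (threshold r j) W ≡ does (j ≤? hits r W)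
eval-threshold r       zero    W = refl
eval-threshold []      (suc j) W = refl
eval-threshold (x ∷ r) (suc j) W with lookup W x in eq | x ∈? W
... | true  | yes _  = trans (eval-threshold r j W) (≤ᵇ-suc j (hits r W))
  where
  ≤ᵇ-suc : ∀ i j → (i ≤ᵇ j) ≡ (suc i ≤ᵇ suc j)
  ≤ᵇ-suc zero    j = refl
  ≤ᵇ-suc (suc i) j = refl
... | true  | no x∉W = ⊥-elim (x∉W (lookup⇒[]= x W eq))
... | false | no _   = eval-threshold r (suc j) W
... | false | yes x∈W with trans (sym eq) ([]=⇒lookup x∈W)
...   | ()

hits-mono : ∀ {L} (r : Vec (Fin s) L) {V W} → V ⊆ W → hits r V ≤ hits r W
hits-mono []      V⊆W = z≤n
hits-mono (x ∷ r) {V} {W} V⊆W = +-mono-≤ (𝟙-mono (x ∈? V) (x ∈? W) V⊆W) (hits-mono r V⊆W)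

hits-∁ : ∀ {L} (r : Vec (Fin s) L) W → hits r (∁ W) + hits r W ≡ L
hits-∁ []      W = refl
hits-∁ (x ∷ r) W = trans (shuffle (𝟙 (x ∈? ∁ W)) (hits r (∁ W)) (𝟙 (x ∈? W)) (hits r W))
  (cong₂ _+_ one (hits-∁ r W))
  where
  shuffle : ∀ a b c d → (a + b) + (c + d) ≡ (a + c) + (b + d)
  shuffle = solve-∀
  one : 𝟙 (x ∈? ∁ W) + 𝟙 (x ∈? W) ≡ 1
  one with x ∈? W
  ... | yes x∈W = cong (_+ 1) (𝟙-no (x ∈? ∁ W) (λ x∈∁W → x∈∁p⇒x∉p x∈∁W x∈W))
  ... | no  x∉W = cong (_+ 0) (𝟙-yes (x ∈? ∁ W) (x∉p⇒x∈∁p x∉W))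

-- Distinct addresses of p occupy distinct positions of the row. This converts the number of private
-- addresses into votes.
∣p∣≤hits : ∀ {L} (r : Vec (Fin s) L) {p W} → p ⊆ nbrs r → p ⊆ W → ∣ p ∣ ≤ hits r W
∣p∣≤hits {s} [] p⊆ _ = ≤-trans (p⊆q⇒∣p∣≤∣q∣ p⊆) (≤-reflexive (∣⊥∣≡0 s))
∣p∣≤hits {s} (x ∷ r) {p} {W} p⊆ p⊆W = begin
  ∣ p ∣                                ≤⟨ p⊆q⇒∣p∣≤∣q∣ split ⟩
  ∣ (p ∩ ⁅ x ⁆) ∪ (p ∩ nbrs r) ∣       ≤⟨ ∣p∪q∣≤∣p∣+∣q∣ (p ∩ ⁅ x ⁆) (p ∩ nbrs r) ⟩
  ∣ p ∩ ⁅ x ⁆ ∣ + ∣ p ∩ nbrs r ∣       ≤⟨ +-mono-≤ head (∣p∣≤hits r (p∩q⊆q p (nbrs r)) (p⊆W ∘ p∩q⊆p p (nbrs r))) ⟩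
  𝟙 (x ∈? W) + hits r W                ∎
  where
  open ≤-Reasoning
  split : p ⊆ (p ∩ ⁅ x ⁆) ∪ (p ∩ nbrs r)
  split y∈p with x∈p∪q⁻ ⁅ x ⁆ (nbrs r) (p⊆ y∈p)
  ... | inj₁ y∈x = p⊆p∪q (p ∩ nbrs r) (x∈p∩q⁺ (y∈p , y∈x))
  ... | inj₂ y∈r = q⊆p∪q (p ∩ ⁅ x ⁆) _ (x∈p∩q⁺ (y∈p , y∈r))
  head : ∣ p ∩ ⁅ x ⁆ ∣ ≤ 𝟙 (x ∈? W)
  head with x ∈? W
  ... | yes _  = ≤-trans (∣p∩q∣≤∣q∣ p ⁅ x ⁆) (≤-reflexive (∣⁅x⁆∣≡1 x))
  ... | no x∉W = ≤-reflexive (trans (cong ∣_∣ (Empty-unique empty)) (∣⊥∣≡0 s))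
    where
    empty : ¬ ∃ (_∈ p ∩ ⁅ x ⁆)
    empty (y , y∈) with x∈p∩q⁻ p ⁅ x ⁆ y∈
    ... | y∈p , y∈x = x∉W (subst (_∈ W) (x∈⁅y⁆⇒x≡y x y∈x) (p⊆W y∈p))

∈-excess : ∀ {t} d W (S : Subset m) (G : Vec (Vec (Fin s) t) m) {u} →
           u ∉ S → d ≤ hits (lookup G u) W → u ∈ excess d W S G
∈-excess d W (true  ∷ S) (r ∷ G) {zero}  u∉S _ = ⊥-elim (u∉S here)
∈-excess d W (false ∷ S) (r ∷ G) {zero}  u∉S d≤ =
  subst (λ b → zero ∈ b ∷ excess d W S G) (sym (dec-true (d ≤? hits r W) d≤)) here
∈-excess d W (true  ∷ S) (r ∷ G) {suc u} u∉S d≤ = there (∈-excess d W S G (u∉S ∘ there) d≤)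
∈-excess d W (false ∷ S) (r ∷ G) {suc u} u∉S d≤ = there (∈-excess d W S G (u∉S ∘ there) d≤)

module _ {m s t d n R : ℕ} (t<d+d : t < d + d) (G : Vec (Vec (Fin s) t) m) (good : Good d n R G) where

  Encodes : Subset m → Subset s → Set
  Encodes S W = ∀ u → (u ∈ S → d ≤ hits (lookup G u) W) × (u ∉ S → ¬ (d ≤ hits (lookup G u) W))

  -- Every address is 0 except the private addresses of the members of S; the
  -- non-members that see many addresses of S are protected by private 0's.
  encode : ∀ S → ∣ S ∣ ≤ n → ∃ (Encodes S)
  encode S ∣S∣≤n = W , λ u → member u , nonmember u
    where
    F : Fin m → Subset s
    F u = nbrs (lookup G u)
    T = excess d (N G S) S G
    A = S ∪ T
    hallA : Hall d A F
    hallA B B⊆A with ∣ B ∣ in eq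
    ... | zero  = ≤-trans (≤-reflexive (*-zeroʳ d)) z≤n
    ... | suc b = subst (λ x → d * x ≤ ∣ N G B ∣) eq (<⇒≤ (proj₁ good B (≤-trans (s≤s z≤n) (≤-reflexive (sym eq)))
      (≤-trans (p⊆q⇒∣p∣≤∣q∣ B⊆A) (≤-trans (∣p∪q∣≤∣p∣+∣q∣ S T) (+-mono-≤ ∣S∣≤n (<⇒≤ (proj₂ good S ∣S∣≤n)))))))
    P,private : ∃ (Private d A F)
    P,private = private-neighbours d A F hallA
    P = proj₁ P,private
    P⊆F : ∀ u → P u ⊆ F u
    P⊆F = proj₁ (proj₂ P,private)
    d≤P : ∀ {u} → u ∈ A → d ≤ ∣ P u ∣
    d≤P = proj₁ (proj₂ (proj₂ P,private))
    disjoint : ∀ {u v x} → u ∈ A → v ∈ A → x ∈ P u → x ∈ P v → u ≡ v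
    disjoint = proj₂ (proj₂ (proj₂ P,private))
    W = cover P S
    S⊆A : S ⊆ A
    S⊆A = p⊆p∪q T
    W⊆N : W ⊆ N G S
    W⊆N x∈ with ∈-cover⁻ P S x∈
    ... | u , u∈S , x∈P = ∈-cover⁺ F u∈S (P⊆F u x∈P)
    member : ∀ u → u ∈ S → d ≤ hits (lookup G u) W
    member u u∈S = ≤-trans (d≤P (S⊆A u∈S)) (∣p∣≤hits (lookup G u) (P⊆F u) (∈-cover⁺ P u∈S))
    nonmember : ∀ u → u ∉ S → ¬ (d ≤ hits (lookup G u) W)
    -- A wrong majority would itself make u exceptional. Its d private addresses outside W would
    -- then come on top of d hits inside W, too many for t positions.
    nonmember u u∉S d≤W = <⇒≱ t<d+d (begin
      d + d
        ≤⟨ +-mono-≤ (≤-trans (d≤P u∈A) (∣p∣≤hits (lookup G u) (P⊆F u) outside-W)) d≤W ⟩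
      hits (lookup G u) (∁ W) + hits (lookup G u) W     ≡⟨ hits-∁ (lookup G u) W ⟩
      t                                                 ∎)
      where
      open ≤-Reasoning
      u∈A : u ∈ A
      u∈A = q⊆p∪q S T (∈-excess d (N G S) S G u∉S (≤-trans d≤W (hits-mono (lookup G u) W⊆N)))
      outside-W : P u ⊆ ∁ W
      outside-W x∈Pu = x∉p⇒x∈∁p λ x∈W → let v , v∈S , x∈Pv = ∈-cover⁻ P S x∈W in
        u∉S (subst (_∈ S) (sym (disjoint u∈A (S⊆A v∈S) x∈Pu x∈Pv)) v∈S)

  storing : StoringScheme m s
  storing S with ∣ S ∣ ≤? n
  ... | yes ∣S∣≤n = proj₁ (encode S ∣S∣≤n)
  -- Larger sets carry no requirement; the zero string is a default.
  ... | no  _     = ⊥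

  querying : QueryScheme m s t
  querying = (λ u → threshold (lookup G u) d) , (λ u → depth-threshold (lookup G u) d)

  storing-correct : ∀ S → ∣ S ∣ ≤ n → Encodes S (storing S)
  storing-correct S ∣S∣≤n with ∣ S ∣ ≤? n
  ... | yes p     = proj₂ (encode S p)
  ... | no ∣S∣≰n = ⊥-elim (∣S∣≰n ∣S∣≤n)

  isScheme : IsScheme m n s t storing querying
  isScheme S ∣S∣≤n u = mk⇔ sound complete
    where
    r = lookup G u
    W = storing S
    sound : eval (threshold r d) W ≡ true → u ∈ S
    sound eq with u ∈? S
    ... | yes u∈S = u∈S
    ... | no  u∉S with trans (sym eq) (trans (eval-threshold r d W)
                    (dec-false (d ≤? hits r W) (proj₂ (storing-correct S ∣S∣≤n u) u∉S)))
    ...   | ()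
    complete : u ∈ S → eval (threshold r d) W ≡ true
    complete u∈S = trans (eval-threshold r d W)
      (dec-true (d ≤? hits r W) (proj₁ (storing-correct S ∣S∣≤n u) u∈S))

  nonAdaptive : NonAdaptive {m} {s} {t} querying
  nonAdaptive u = toList (lookup G u) , ≤-reflexive (length-toList (lookup G u)) ,
    λ W i → probes-threshold (lookup G u) d W

-- The size of the scheme


^-swap : ∀ x i j → (x ^ i) ^ j ≡ (x ^ j) ^ i
^-swap x i j = trans (^-*-assoc x i j) (trans (cong (x ^_) (*-comm i j)) (sym (^-*-assoc x j i)))

-- With s ≤ 2c t r m^(1/k) n^(1-1/k) the hypothesis of SizeBound gives (e + 1) a < r b,
-- and r ≤ (e + 1) lg(2m/n) because 2^r ≤ 2^e (2m/n) and 2m/n ≥ 2.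
sizeBound : ∀ c e κ m n s r z .⦃ _ : NonZero c ⦄ .⦃ _ : NonZero n ⦄ → let k = suc κ ; t = k + suc k in
  n ≤ m → z * n ≤ 2 * m → 1 ≤ r → 2 ^ r ≤ 2 ^ e * z →
  s ^ k ≤ 2 ^ k * ((c * t) ^ k * (m * (r * n) ^ κ)) →
  SizeBound (suc e * (2 * c)) t m n s
sizeBound c e κ m n s r z n≤m zn≤2m 1≤r 2^r≤2^e*z s^k≤ a b _ hyp = ^-cancelˡ-< (suc e) (begin-strict
  (2 ^ a * n ^ b) ^ suc e          ≡⟨ ^-distribʳ-* (2 ^ a) (n ^ b) (suc e) ⟩
  (2 ^ a) ^ suc e * (n ^ b) ^ suc e
    ≡⟨ cong₂ _*_ (trans (^-*-assoc 2 a (suc e)) (cong (2 ^_) (*-comm a (suc e)))) (^-swap n b (suc e)) ⟩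
  2 ^ (suc e * a) * (n ^ suc e) ^ b
    <⟨ *-monoˡ-< ((n ^ suc e) ^ b) ⦃ m^n≢0 (n ^ suc e) b ⦃ m^n≢0 n (suc e) ⦄ ⦄ (^-monoʳ-< 2 ≤-refl [1+e]a<rb) ⟩
  2 ^ (r * b) * (n ^ suc e) ^ b    ≡⟨ cong (_* (n ^ suc e) ^ b) (sym (^-*-assoc 2 r b)) ⟩
  (2 ^ r) ^ b * (n ^ suc e) ^ b    ≡⟨ ^-distribʳ-* (2 ^ r) (n ^ suc e) b ⟨
  (2 ^ r * n ^ suc e) ^ b          ≤⟨ ^-monoˡ-≤ b 2^r*n^[1+e]≤[2m]^[1+e] ⟩
  ((2 * m) ^ suc e) ^ b            ≡⟨ ^-swap (2 * m) (suc e) b ⟩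
  ((2 * m) ^ b) ^ suc e            ∎)
  where
  open ≤-Reasoning
  k = suc κ
  t = k + suc k
  C = suc e * (2 * c)
  Y = m * n ^ κ

  2^r*n^[1+e]≤[2m]^[1+e] : 2 ^ r * n ^ suc e ≤ (2 * m) ^ suc e
  2^r*n^[1+e]≤[2m]^[1+e] = begin
    2 ^ r * n ^ suc e              ≤⟨ *-monoˡ-≤ (n ^ suc e) 2^r≤2^e*z ⟩
    2 ^ e * z * (n * n ^ e)        ≡⟨ shuffle (2 ^ e) z n (n ^ e) ⟩
    z * n * (2 ^ e * n ^ e)        ≡⟨ cong (z * n *_) (sym (^-distribʳ-* 2 n e)) ⟩
    z * n * (2 * n) ^ e            ≤⟨ *-mono-≤ zn≤2m (^-monoˡ-≤ e (*-monoʳ-≤ 2 n≤m)) ⟩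
    2 * m * (2 * m) ^ e            ∎
    where
    shuffle : ∀ a z n p → a * z * (n * p) ≡ z * n * (a * p)
    shuffle = solve-∀

  t∸1≡k*2 : κ + suc k ≡ k * 2
  t∸1≡k*2 = eq κ
    where
    eq : ∀ κ → κ + suc (suc κ) ≡ suc κ * 2
    eq = solve-∀

  -- `SizeBound` has the exponent t - 1 = 2k, so its hypothesis is the square of this inequality.
  root : (a * C * t) ^ k * Y < (s * b) ^ k
  root = ^-cancelˡ-< 2 (begin-strict
    ((a * C * t) ^ k * Y) ^ 2
      ≡⟨ ^-distribʳ-* ((a * C * t) ^ k) Y 2 ⟩
    ((a * C * t) ^ k) ^ 2 * Y ^ 2
      ≡⟨ cong₂ _*_ (^-*-assoc (a * C * t) k 2)
           (trans (^-distribʳ-* m (n ^ κ) 2) (cong (m ^ 2 *_) (^-*-assoc n κ 2))) ⟩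
    (a * C * t) ^ (k * 2) * (m ^ 2 * n ^ (k * 2 ∸ 2))
      ≡⟨ *-assoc ((a * C * t) ^ (k * 2)) (m ^ 2) _ ⟨
    (a * C * t) ^ (k * 2) * m ^ 2 * n ^ (k * 2 ∸ 2)
      <⟨ subst (λ e → (a * C * t) ^ e * m ^ 2 * n ^ (e ∸ 2) < (s * b) ^ e) t∸1≡k*2 hyp ⟩
    (s * b) ^ (k * 2)
      ≡⟨ ^-*-assoc (s * b) k 2 ⟨
    ((s * b) ^ k) ^ 2
      ∎)

  -- Replacing r^(k-1) by r^k lets the whole of r enter the k-th power, where it becomes the
  -- logarithmic factor.
  s^k≤[2ctr]^k*Y : s ^ k ≤ (2 * (c * t) * r) ^ k * Y
  s^k≤[2ctr]^k*Y = begin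
    s ^ k                                          ≤⟨ s^k≤ ⟩
    2 ^ k * ((c * t) ^ k * (m * (r * n) ^ κ))      ≡⟨ cong (λ x → 2 ^ k * ((c * t) ^ k * (m * x))) (^-distribʳ-* r n κ) ⟩
    2 ^ k * ((c * t) ^ k * (m * (r ^ κ * n ^ κ)))  ≡⟨ shuffle (2 ^ k) ((c * t) ^ k) m (r ^ κ) (n ^ κ) ⟩
    2 ^ k * (c * t) ^ k * r ^ κ * Y
      ≤⟨ *-monoˡ-≤ Y (*-monoʳ-≤ (2 ^ k * (c * t) ^ k) (^-monoʳ-≤ r ⦃ >-nonZero 1≤r ⦄ (n≤1+n κ))) ⟩
    2 ^ k * (c * t) ^ k * r ^ k * Y                ≡⟨ cong (λ x → x * r ^ k * Y) (sym (^-distribʳ-* 2 (c * t) k)) ⟩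
    (2 * (c * t)) ^ k * r ^ k * Y                  ≡⟨ cong (_* Y) (sym (^-distribʳ-* (2 * (c * t)) r k)) ⟩
    (2 * (c * t) * r) ^ k * Y                      ∎
    where
    shuffle : ∀ x y m p q → x * (y * (m * (p * q))) ≡ x * y * p * (m * q)
    shuffle = solve-∀

  [1+e]a<rb : suc e * a < r * b
  [1+e]a<rb = *-cancelˡ-< (2 * (c * t)) _ _ (≤-<-trans (≤-reflexive (shuffle₁ a c e t)) (<-≤-trans
    (^-cancelˡ-< k (*-cancelʳ-< Y _ _ (begin-strict
      (a * C * t) ^ k * Y                   <⟨ root ⟩
      (s * b) ^ k                           ≡⟨ ^-distribʳ-* s b k ⟩
      s ^ k * b ^ k                         ≤⟨ *-monoˡ-≤ (b ^ k) s^k≤[2ctr]^k*Y ⟩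
      (2 * (c * t) * r) ^ k * Y * b ^ k     ≡⟨ shuffle₂ ((2 * (c * t) * r) ^ k) Y (b ^ k) ⟩
      (2 * (c * t) * r) ^ k * b ^ k * Y     ≡⟨ cong (_* Y) (sym (^-distribʳ-* (2 * (c * t) * r) b k)) ⟩
      (2 * (c * t) * r * b) ^ k * Y         ∎)))
    (≤-reflexive (*-assoc (2 * (c * t)) r b))))
    where
    shuffle₁ : ∀ a c e t → 2 * (c * t) * (suc e * a) ≡ a * (suc e * (2 * c)) * t
    shuffle₁ = solve-∀
    shuffle₂ : ∀ x y z → x * y * z ≡ x * z * y
    shuffle₂ = solve-∀

-- The origin of 256: 2^t = 2 · 4^k, and n + R ≤ 2R costs at most another 2^k, so with the factor 16
-- the total is 32 · 8^k ≤ 256^k, as k ≥ 1. The factor d^k is absorbed by t^k.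
tableSize-large : ∀ κ m n r s → let k = suc κ ; d = suc k ; t = k + d in 1 ≤ r →
  (256 * t) ^ k * (m * (r * n) ^ κ) ≤ s ^ k →
  16 * (2 ^ t * (d ^ k * (m * (n + r * n) ^ κ))) ≤ s ^ k
tableSize-large κ m n r s 1≤r X≤s^k = begin
  16 * (2 ^ t * (d ^ k * (m * (n + R) ^ κ)))
    ≤⟨ *-monoʳ-≤ 16 (*-monoʳ-≤ (2 ^ t) (*-mono-≤ (^-monoˡ-≤ k (m≤n+m d k)) (*-monoʳ-≤ m [n+R]^κ≤))) ⟩
  16 * (2 ^ t * (t ^ k * (m * (2 ^ k * R ^ κ))))
    ≡⟨ cong (λ x → 16 * (x * (t ^ k * (m * (2 ^ k * R ^ κ))))) (^-distribˡ-+-* 2 k d) ⟩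
  16 * (2 ^ k * (2 * 2 ^ k) * (t ^ k * (m * (2 ^ k * R ^ κ))))
    ≡⟨ shuffle (2 ^ k) (t ^ k) m (R ^ κ) ⟩
  32 * (2 ^ k * (2 ^ k * 2 ^ k)) * t ^ k * (m * R ^ κ)
    ≤⟨ *-monoˡ-≤ (m * R ^ κ) (*-monoˡ-≤ (t ^ k) 32*8^k≤256^k) ⟩
  256 ^ k * t ^ k * (m * R ^ κ)
    ≡⟨ cong (_* (m * R ^ κ)) (^-distribʳ-* 256 t k) ⟨
  (256 * t) ^ k * (m * R ^ κ)
    ≤⟨ X≤s^k ⟩
  s ^ k
    ∎
  where
  open ≤-Reasoning
  k = suc κ
  d = suc k
  t = k + d
  R = r * n
  [n+R]^κ≤ : (n + R) ^ κ ≤ 2 ^ k * R ^ κ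
  [n+R]^κ≤ = begin
    (n + R) ^ κ       ≤⟨ ^-monoˡ-≤ κ (+-mono-≤ (m≤n*m n r ⦃ >-nonZero 1≤r ⦄) (≤-reflexive (sym (+-identityʳ R)))) ⟩
    (2 * R) ^ κ       ≡⟨ ^-distribʳ-* 2 R κ ⟩
    2 ^ κ * R ^ κ     ≤⟨ *-monoˡ-≤ (R ^ κ) (^-monoʳ-≤ 2 (n≤1+n κ)) ⟩
    2 ^ k * R ^ κ     ∎
  32*8^k≤256^k : 32 * (2 ^ k * (2 ^ k * 2 ^ k)) ≤ 256 ^ k
  32*8^k≤256^k = begin
    32 * (2 ^ k * (2 ^ k * 2 ^ k))       ≤⟨ *-monoˡ-≤ (2 ^ k * (2 ^ k * 2 ^ k)) (m≤m*n 32 (32 ^ κ) ⦃ m^n≢0 32 κ ⦄) ⟩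
    32 ^ k * (2 ^ k * (2 ^ k * 2 ^ k))   ≡⟨ cong (λ x → 32 ^ k * (2 ^ k * x)) (^-distribʳ-* 2 2 k) ⟨
    32 ^ k * (2 ^ k * 4 ^ k)             ≡⟨ cong (32 ^ k *_) (^-distribʳ-* 2 4 k) ⟨
    32 ^ k * 8 ^ k                       ≡⟨ ^-distribʳ-* 32 8 k ⟨
    256 ^ k                              ∎
  shuffle : ∀ p q m u → 16 * (p * (2 * p) * (q * (m * (p * u)))) ≡ 32 * (p * (p * p)) * q * (m * u)
  shuffle = solve-∀

-- One of the k + 1 factors t n is at most s. In the remaining k-th power, z n ≤ 2m turns z n^k into
-- at most 2 m n^(k-1), which the lower bound on s^k covers.
tableSize-sparse : ∀ κ m n r s z → let k = suc κ ; d = suc k ; t = k + d in 1 ≤ r → n ≤ m → z * n ≤ 2 * m →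
  (256 * t) ^ k * (m * (r * n) ^ κ) ≤ s ^ k →
  z * (2 ^ t * (t * n) ^ d) ≤ s ^ d
tableSize-sparse κ m n r s z 1≤r n≤m zn≤2m X≤s^k = begin
  z * (2 ^ t * (t * n * (t * n) ^ k))
    ≡⟨ cong (λ x → z * (2 ^ t * (t * n * x))) (^-distribʳ-* t n k) ⟩
  z * (2 ^ t * (t * n * (t ^ k * (n * n ^ κ))))
    ≡⟨ cong (λ x → z * (x * (t * n * (t ^ k * (n * n ^ κ))))) (^-distribˡ-+-* 2 k d) ⟩
  z * (2 ^ k * (2 * 2 ^ k) * (t * n * (t ^ k * (n * n ^ κ))))
    ≡⟨ shuffle₁ z (2 ^ k) (t * n) (t ^ k) n (n ^ κ) ⟩
  t * n * (2 * (2 ^ k * 2 ^ k) * t ^ k * (z * n * n ^ κ))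
    ≤⟨ *-mono-≤ tn≤s (*-monoʳ-≤ (2 * (2 ^ k * 2 ^ k) * t ^ k) (*-monoˡ-≤ (n ^ κ) zn≤2m)) ⟩
  s * (2 * (2 ^ k * 2 ^ k) * t ^ k * (2 * m * n ^ κ))
    ≡⟨ cong (s *_) (shuffle₂ (2 ^ k) (t ^ k) m (n ^ κ)) ⟩
  s * (4 * (2 ^ k * 2 ^ k) * t ^ k * (m * n ^ κ))
    ≤⟨ *-monoʳ-≤ s (*-mono-≤ (*-monoˡ-≤ (t ^ k) 4*4^k≤256^k) (*-monoʳ-≤ m n^κ≤R^κ)) ⟩
  s * (256 ^ k * t ^ k * (m * R ^ κ))
    ≡⟨ cong (λ x → s * (x * (m * R ^ κ))) (^-distribʳ-* 256 t k) ⟨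
  s * ((256 * t) ^ k * (m * R ^ κ))
    ≤⟨ *-monoʳ-≤ s X≤s^k ⟩
  s ^ d
    ∎
  where
  open ≤-Reasoning
  k = suc κ
  d = suc k
  t = k + d
  R = r * n
  n^κ≤R^κ : n ^ κ ≤ R ^ κ
  n^κ≤R^κ = ^-monoˡ-≤ κ (m≤n*m n r ⦃ >-nonZero 1≤r ⦄)
  tn≤s : t * n ≤ s
  tn≤s = ^-cancelˡ-≤ κ (begin
    (t * n) ^ k                    ≡⟨ ^-distribʳ-* t n k ⟩
    t ^ k * (n * n ^ κ)            ≤⟨ *-mono-≤ (^-monoˡ-≤ k (m≤n*m t 256)) (*-mono-≤ n≤m n^κ≤R^κ) ⟩
    (256 * t) ^ k * (m * R ^ κ)    ≤⟨ X≤s^k ⟩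
    s ^ k                          ∎)
  4*4^k≤256^k : 4 * (2 ^ k * 2 ^ k) ≤ 256 ^ k
  4*4^k≤256^k = begin
    4 * (2 ^ k * 2 ^ k)        ≤⟨ *-monoˡ-≤ (2 ^ k * 2 ^ k) (m≤m*n 4 (4 ^ κ) ⦃ m^n≢0 4 κ ⦄) ⟩
    4 ^ k * (2 ^ k * 2 ^ k)    ≡⟨ cong (4 ^ k *_) (^-distribʳ-* 2 2 k) ⟨
    4 ^ k * 4 ^ k              ≡⟨ ^-distribʳ-* 4 4 k ⟨
    16 ^ k                     ≤⟨ ^-monoˡ-≤ k (m≤m+n 16 240) ⟩
    256 ^ k                    ∎
  shuffle₁ : ∀ z p w q n u → z * (p * (2 * p) * (w * (q * (n * u)))) ≡ w * (2 * (p * p) * q * (z * n * u))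
  shuffle₁ = solve-∀
  shuffle₂ : ∀ p q m u → 2 * (p * p) * q * (2 * m * u) ≡ 4 * (p * p) * q * (m * u)
  shuffle₂ = solve-∀

-- Choice of parameters

Scheme : (C t m n : ℕ) → Set
Scheme C t m n = ∃ λ (s : ℕ) → Σ (StoringScheme m s) λ φ → Σ (QueryScheme m s t) λ Q →
  IsScheme m n s t φ Q × NonAdaptive Q × SizeBound C t m n s

∃-scheme : ∀ κ m n → 1 ≤ n → n ≤ m → Scheme 4096 (suc κ + suc (suc κ)) m n
∃-scheme κ m n@(suc _) 1≤n n≤m =
  s₀ , storing t<d+d G good , querying t<d+d G good , isScheme t<d+d G good , nonAdaptive t<d+d G good ,
  -- Here e = 7 because 2^r ≤ 128 z = 2^7 z, and c = 256 is the constant in `K`; hence C = (7 + 1) ·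
  -- 2 · 256 = 4096.
  sizeBound 256 7 κ m n s₀ r z n≤m zn≤2m 1≤r 2^r≤128z s^k≤2^k*K
  where
  k = suc κ
  d = suc k
  t = k + d
  -- Rounding m/n up past its floor gives m ≤ z n, while z n ≤ n + m ≤ 2m still holds.
  z = suc (m / n)
  m≤zn : m ≤ z * n
  m≤zn = ≤-trans (≤-reflexive (m≡m%n+[m/n]*n m n)) (+-monoˡ-≤ (m / n * n) (<⇒≤ (m%n<n m n)))
  zn≤2m : z * n ≤ 2 * m
  zn≤2m = ≤-trans (+-mono-≤ n≤m (m/n*n≤m m n)) (≤-reflexive (cong (m +_) (sym (+-identityʳ m))))

  log : ∃ λ r → 64 * z ≤ 2 ^ r × 2 ^ r ≤ 2 * (64 * z)
  log = ceil-log (64 * z) (s≤s z≤n)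
  r = proj₁ log
  64z≤2^r : 64 * z ≤ 2 ^ r
  64z≤2^r = proj₁ (proj₂ log)
  2^r≤128z : 2 ^ r ≤ 2 ^ 7 * z
  2^r≤128z = ≤-trans (proj₂ (proj₂ log)) (≤-reflexive (sym (*-assoc 2 64 z)))
  1≤r : 1 ≤ r
  1≤r = positive r (≤-trans (m≤m*n 64 z) 64z≤2^r)
    where
    positive : ∀ r → 64 ≤ 2 ^ r → 1 ≤ r
    positive zero    (s≤s ())
    positive (suc r) _ = s≤s z≤n

  -- The smallest value of s^k that both size lemmas accept; s₀ is its k-th root, rounded up within
  -- a factor 2.
  K = (256 * t) ^ k * (m * (r * n) ^ κ)
  1≤K : 1 ≤ K
  1≤K = *-mono-≤ (m^n>0 (256 * t) k)
    (*-mono-≤ (≤-trans 1≤n n≤m) (m^n>0 (r * n) ⦃ >-nonZero (*-mono-≤ 1≤r 1≤n) ⦄ κ))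
  root : ∃ λ s → K ≤ s ^ k × s ^ k ≤ 2 ^ k * K
  root = ceil-root κ K 1≤K
  s₀ = proj₁ root
  K≤s^k : K ≤ s₀ ^ k
  K≤s^k = proj₁ (proj₂ root)
  s^k≤2^k*K : s₀ ^ k ≤ 2 ^ k * K
  s^k≤2^k*K = proj₂ (proj₂ root)
  s≢0 : NonZero s₀
  s≢0 = positive s₀ (≤-trans 1≤K K≤s^k)
    where
    positive : ∀ s → 1 ≤ s ^ k → NonZero s
    positive (suc s) _ = _

  t<d+d : t < d + d
  t<d+d = ≤-refl
  G,good : ∃ λ (G : Vec (Vec (Fin s₀) t) m) → Good d n (r * n) G
  G,good = ∃-good m s₀ ⦃ s≢0 ⦄ κ d n z r 1≤n m≤zn 64z≤2^r
    (tableSize-large κ m n r s₀ 1≤r K≤s^k) (tableSize-sparse κ m n r s₀ z 1≤r n≤m zn≤2m K≤s^k)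
  G = proj₁ G,good
  good : Good d n (r * n) G
  good = proj₂ G,good

theorem4 : ∃ λ (C : ℕ) → 1 ≤ C ×
    (∀ (t : ℕ) → 5 ≤ t → (∃ λ j → t ≡ 2 * j + 1) →
    ∃ λ (M : ℕ) → ∀ (m n : ℕ) → M ≤ m → 1 ≤ n → n ≤ m →
    ∃ λ (s : ℕ) → Σ (StoringScheme m s) λ φ → Σ (QueryScheme m s t) λ Q →
    IsScheme m n s t φ Q × NonAdaptive Q × SizeBound C t m n s)
theorem4 = 4096 , s≤s z≤n , λ where
    t 5≤t (suc κ , refl) → 0 , λ m n _ 1≤n n≤m →
      subst (λ t → Scheme 4096 t m n) (k+1+k≡2k+1 (suc κ)) (∃-scheme κ m n 1≤n n≤m)
    .1 (s≤s ()) (zero , refl)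
  where
  k+1+k≡2k+1 : ∀ k → k + suc k ≡ 2 * k + 1
  k+1+k≡2k+1 = solve-∀
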